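{- Let $r\ge 0$ be an integer and let $a,b$ be indeterminates. For all integers $n,m,k\ge 0$, $$\mathcal{G}_{a,b}(n+m,k;r)=\sum_{i=0}^n\sum_{j=0}^m \binom{n}{i}\,\mathcal{G}_{a,b}(m,j;r)\,\mathcal{G}_{a,b}(i,k-j;0)\prod_{\ell=0}^{n-i-1}\bigl(a\ell+a(m+r)+b(j+r)\bigr).$$
   Context: Write $[m]=\{1,\ldots,m\}$, $[0]=\varnothing$. A Lah distribution of $[m]$ into $\ell$ blocks is a partition of $[m]$ into $\ell$ non-empty, pairwise disjoint blocks in which the elements within each block are linearly ordered (the blocks themselves are not ordered). For integers $n,k,r$ with $0\le k\le n$ and $r\ge 0$, let $\mathcal{L}_r(n,k)$ be the set of Lah distributions of $[n+r]$ into $k+r$ blocks in which the elements of $[r]$ belong to distinct blocks. An element $i$ of a Lah distribution $\lambda$ is a record low if there is no element $j<i$ to the left of $i$ within its block. Let $rec^*(\lambda)$ be the number of record lows of $\lambda$ that are not the smallest element of their block, and let $nrec(\lambda)$ be the number of elements of the underlying set that are not record lows of $\lambda$. The generalized $r$-Lah number is the polynomial in indeterminates $a,b$ $$\mathcal{G}_{a,b}(n,k;r)=\sum_{\lambda\in\mathcal{L}_r(n,k)}a^{nrec(\lambda)}b^{rec^*(\lambda)},$$ with $\mathcal{G}_{a,b}(n,k;r)=0$ unless $0\le k\le n$ and $r\ge 0$. Empty sums are $0$ and empty products are $1$. -}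

module Defs where

open import Algebra.Bundles using (CommutativeRing; Semiring)
open import Data.Fin.Base using (Fin)
open import Data.Integer.Base using (ℤ; +_; -[1+_])
open import Data.List.Base using (List; []; _∷_; length; map; foldr; filter; upTo; takeWhile; concatMap; cartesianProductWith)
open import Data.List.Extrema.Nat using (min)
open import Data.List.Membership.DecPropositional using () renaming (_∈?_ to ∈?)
open import Data.List.Membership.Propositional using (_∈_)
open import Data.List.Membership.Propositional.Properties using (∈-cartesianProductWith⁺; ∈-cartesianProductWith⁻; ∈-filter⁺; ∈-filter⁻; ∈-concatMap⁺)
open import Data.List.Membership.Propositional.Properties.WithK using (unique∧set⇒bag)
open import Data.List.NonEmpty.Base using (List⁺; _∷_; toList)
open import Data.List.Properties using (length-map; length-upTo; length-++)
open import Data.List.Relation.Binary.BagAndSetEquality using (∼bag⇒↭)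
open import Data.List.Relation.Binary.Permutation.Propositional using (_↭_)
open import Data.List.Relation.Binary.Permutation.Propositional.Properties using (↭-length)
open import Data.List.Relation.Unary.All as All using (All; []; _∷_; all?)
open import Data.List.Relation.Unary.AllPairs using (AllPairs; []; _∷_; allPairs?)
open import Data.List.Relation.Unary.Any as Any using (Any; here; there; any?)
open import Data.List.Relation.Unary.Unique.Propositional using (Unique)
import Data.List.Relation.Unary.Unique.Propositional.Properties as Unique
open import Data.Nat.Base using (ℕ; zero; suc; _+_; _<_; _≤_; z≤n; s≤s)
open import Data.Nat.ListAction using (sum)
open import Data.Nat.Properties using (_≟_; _<?_; suc-injective; ≤-refl; ≤-trans; ≤-reflexive; m≤m+n; m≤n+m; n≤1+n)
open import Data.Product.Base using (_×_; _,_; proj₂)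
open import Function.Bundles using (_⇔_; mk⇔)
open import Relation.Binary.PropositionalEquality using (_≡_; _≢_; refl; trans)
open import Relation.Nullary using (¬_; Dec)
open import Relation.Nullary.Decidable using (map′; ¬?; _×-dec_)

[1⋯_] : ℕ → List ℕ
[1⋯ m ] = map suc (upTo m)

Block : Set
Block = List⁺ ℕ

minimum : Block → ℕ
minimum (x ∷ xs) = min x xs

elements : List Block → List ℕ
elements = concatMap toList

-- The set of blocks is represented by its unique listing in increasing order
-- of the block minima, so that distinct lists are distinct distributions.

record IsLahDistribution (m ℓ : ℕ) (bs : List Block) : Set where
  constructor mkLah
  field
    disjoint : Unique (elements bs)   -- also: no repetition inside a block
    covering : All (_∈ elements bs) [1⋯ m ]
    within   : All (_∈ [1⋯ m ]) (elements bs)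
    blocks   : length bs ≡ ℓ
    ordered  : AllPairs (λ B C → minimum B < minimum C) bs

SameBlock : List Block → ℕ → ℕ → Set
SameBlock bs i j = Any (λ B → i ∈ toList B × j ∈ toList B) bs

record _∈𝓛[_,_,_] (bs : List Block) (r n k : ℕ) : Set where
  constructor mk𝓛
  field
    isLah     : IsLahDistribution (n + r) (k + r) bs
    separated : AllPairs (λ i j → ¬ SameBlock bs i j) [1⋯ r ]

isLah? : ∀ m ℓ bs → Dec (IsLahDistribution m ℓ bs)
isLah? m ℓ bs = map′
  (λ (d , c , w , b , o) → mkLah d c w b o)
  (λ (mkLah d c w b o) → d , c , w , b , o)
  (allPairs? (λ x y → ¬? (x ≟ y)) (elements bs)
    ×-dec all? (λ i → ∈? _≟_ i (elements bs)) [1⋯ m ]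
    ×-dec all? (λ i → ∈? _≟_ i [1⋯ m ]) (elements bs)
    ×-dec (length bs ≟ ℓ)
    ×-dec allPairs? (λ B C → minimum B <? minimum C) bs)

sameBlock? : ∀ bs i j → Dec (SameBlock bs i j)
sameBlock? bs i j = any? (λ B → ∈? _≟_ i (toList B) ×-dec ∈? _≟_ j (toList B)) bs

_∈𝓛?[_,_,_] : ∀ bs r n k → Dec (bs ∈𝓛[ r , n , k ])
bs ∈𝓛?[ r , n , k ] = map′ (λ (l , s) → mk𝓛 l s) (λ (mk𝓛 l s) → l , s)
  (isLah? (n + r) (k + r) bs ×-dec allPairs? (λ i j → ¬? (sameBlock? bs i j)) [1⋯ r ])

-- All lists over an alphabet of length at most a given bound.

lists≤ : ∀ {A : Set} → ℕ → List A → List (List A)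
lists≤ zero    as = [] ∷ []
lists≤ (suc N) as = [] ∷ cartesianProductWith _∷_ as (lists≤ N as)

candidateBlocks : ℕ → List Block
candidateBlocks m = cartesianProductWith _∷_ [1⋯ m ] (lists≤ m [1⋯ m ])

-- 𝓛 r n k lists exactly the bs with bs ∈𝓛[ r , n , k ], each once: see 𝓛-unique
-- and ∈-𝓛 below.

𝓛 : (r n k : ℕ) → List (List Block)
𝓛 r n k = filter (_∈𝓛?[ r , n , k ]) (lists≤ (k + r) (candidateBlocks (n + r)))

-- The elements to the left of i in B; blocks have no repeated elements.

leftOf : Block → ℕ → List ℕ
leftOf B i = takeWhile (λ j → ¬? (j ≟ i)) (toList B)

RecordLow : Block → ℕ → Set
RecordLow B i = All (λ j → ¬ (j < i)) (leftOf B i)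

recordLow? : ∀ B i → Dec (RecordLow B i)
recordLow? B i = all? (λ j → ¬? (j <? i)) (leftOf B i)

rec* : List Block → ℕ
rec* bs = sum (map (λ B → length (filter (λ i → recordLow? B i ×-dec ¬? (i ≟ minimum B)) (toList B))) bs)

nrec : List Block → ℕ
nrec bs = sum (map (λ B → length (filter (λ i → ¬? (recordLow? B i)) (toList B))) bs)

-- The indeterminates a and b are rendered as arbitrary elements of an arbitrary
-- commutative ring: identities of integer polynomials in a and b are those
-- that hold under every such evaluation.

module GeneralizedLah {c ℓ} (R : CommutativeRing c ℓ) where

  open CommutativeRing R using (Carrier; 0#; semiring) renaming (_+_ to _+ᴿ_; _*_ to _*ᴿ_)
  open import Algebra.Properties.Semiring.Sum semiring public using (sum⁺-syntax)
  open import Algebra.Definitions.RawSemiring (Semiring.rawSemiring semiring) public using (product; _^_) renaming (_×_ to _·_)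

  infixl 10 product-syntax

  product-syntax : ∀ n → (Fin n → Carrier) → Carrier
  product-syntax _ = product

  syntax product-syntax n (λ i → x) = ∏[ i < n ] x

  -- For k > n the sum is empty: k + r non-empty disjoint blocks need at least
  -- k + r elements.

  𝓖 : (a b : Carrier) (n : ℕ) (k : ℤ) (r : ℕ) → Carrier
  𝓖 a b n (+ k)    r = foldr _+ᴿ_ 0# (map (λ bs → (a ^ nrec bs) *ᴿ (b ^ rec* bs)) (𝓛 r n k))
  𝓖 a b n -[1+ _ ] r = 0#

lists≤-unique : ∀ {A : Set} N {as : List A} → Unique as → Unique (lists≤ N as)
lists≤-unique zero    u = [] ∷ []
lists≤-unique (suc N) {as} u =
  All.tabulate (λ {x} x∈ → nonempty as x∈)
  ∷ Unique.cartesianProductWith⁺ _∷_ (λ { refl → refl , refl }) u (lists≤-unique N u)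
  where
  nonempty : ∀ bs {x} → x ∈ cartesianProductWith _∷_ bs (lists≤ N as) → [] ≢ x
  nonempty bs x∈ refl with ∈-cartesianProductWith⁻ _∷_ bs (lists≤ N as) x∈
  ... | _ , _ , _ , _ , ()

∈-lists≤ : ∀ {A : Set} {N} {as xs : List A} → length xs ≤ N → All (_∈ as) xs → xs ∈ lists≤ N as
∈-lists≤ {N = zero}  z≤n     []       = here refl
∈-lists≤ {N = suc N} z≤n     []       = here refl
∈-lists≤ {N = suc N} (s≤s p) (x ∷ xs) = there (∈-cartesianProductWith⁺ _∷_ x (∈-lists≤ p xs))

[1⋯]-unique : ∀ m → Unique [1⋯ m ]
[1⋯]-unique m = Unique.map⁺ suc-injective (Unique.upTo⁺ m)

length-elements : ∀ {m ℓ bs} → IsLahDistribution m ℓ bs → length (elements bs) ≡ m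
length-elements {m} l = trans (↭-length elements↭) (trans (length-map suc (upTo m)) (length-upTo m))
  where
  open IsLahDistribution l
  elements↭ = ∼bag⇒↭ (unique∧set⇒bag disjoint ([1⋯]-unique m)
    (mk⇔ (All.lookup within) (All.lookup covering)))

length-block : ∀ {B bs} → B ∈ bs → length (toList B) ≤ length (elements bs)
length-block {bs = B ∷ bs} (here refl) rewrite length-++ (toList B) {elements bs} = m≤m+n _ _
length-block {bs = B ∷ bs} (there B∈) rewrite length-++ (toList B) {elements bs} = ≤-trans (length-block B∈) (m≤n+m _ _)

block∈candidates : ∀ {m} B → length (toList B) ≤ m → All (_∈ [1⋯ m ]) (toList B) → B ∈ candidateBlocks m
block∈candidates (x ∷ xs) p (x∈ ∷ xs∈) = ∈-cartesianProductWith⁺ _∷_ x∈ (∈-lists≤ (≤-trans (n≤1+n _) p) xs∈)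

𝓛-unique : ∀ r n k → Unique (𝓛 r n k)
𝓛-unique r n k = Unique.filter⁺ (_∈𝓛?[ r , n , k ]) (lists≤-unique (k + r)
  (Unique.cartesianProductWith⁺ _∷_ (λ { refl → refl , refl }) ([1⋯]-unique (n + r))
    (lists≤-unique (n + r) ([1⋯]-unique (n + r)))))

∈-𝓛 : ∀ {r n k bs} → bs ∈ 𝓛 r n k ⇔ bs ∈𝓛[ r , n , k ]
∈-𝓛 {r} {n} {k} {bs} = mk⇔
  (λ bs∈ → proj₂ (∈-filter⁻ (_∈𝓛?[ r , n , k ]) {xs = lists≤ (k + r) (candidateBlocks (n + r))} bs∈))
  (λ p → ∈-filter⁺ (_∈𝓛?[ r , n , k ]) (candidate (_∈𝓛[_,_,_].isLah p)) p)
  where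
  candidate : IsLahDistribution (n + r) (k + r) bs → bs ∈ lists≤ (k + r) (candidateBlocks (n + r))
  candidate l = ∈-lists≤ (≤-reflexive blocks) (All.tabulate (λ {B} B∈ →
    block∈candidates B (≤-trans (length-block B∈) (≤-reflexive (length-elements l)))
      (All.tabulate (λ i∈ → All.lookup within (∈-concatMap⁺ toList (Any.map (λ { refl → i∈ }) B∈))))))
    where open IsLahDistribution l

{-# OPTIONS --safe #-}

-- In a Lah distribution with largest element N, either N is a singleton block, which is
-- then the last one, or N was inserted into a block of a distribution of the smaller
-- elements: in front of the block N becomes a record low that is not the minimum (weight b),
-- behind any element it is not a record low (weight a), and no other element changes its
-- status. Hence
--   𝓖(n+1,k;r) = 𝓖(n,k−1;r) + (a(n+r) + b(k+r)) 𝓖(n,k;r),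
-- and both sides of the theorem satisfy the same recurrence in n: Pascal's rule splits the
-- (n+1)-st right-hand side into terms in which either 𝓖(i,k−j;0) or the product advances by
-- one step, and the two coefficients add up to a(n+m+r) + b(k+r).
module Submission where

open import Defs
open import Algebra.Bundles using (CommutativeRing; Monoid)
import Algebra.Definitions.RawMonoid as RawMonoid
import Algebra.Properties.Semiring.Exp as Exp
import Algebra.Properties.Semiring.Mult as Mult
import Algebra.Properties.Semiring.Sum as SemiringSum
import Algebra.Solver.Ring.NaturalCoefficients.Default as Solver
open import Data.Empty using (⊥-elim)
open import Data.Fin.Base as Fin using (Fin; toℕ)
open import Data.Fin.Properties using (pigeonhole; toℕ<n)
open import Data.Integer.Base as ℤ using (ℤ; +_; -[1+_])
import Data.Integer.Properties as ℤ
open import Data.List.Base using (List; []; _∷_; [_]; _++_; _∷ʳ_; length; map; filter; foldr; concatMap; takeWhile; upTo; lookup)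
open import Data.List.Extrema.Nat using (min≤⊤; min≤xs; argmin-sel)
open import Data.List.Membership.Propositional using (_∈_; _∉_; find; lose)
open import Data.List.Membership.Propositional.Properties
open import Data.List.Membership.Propositional.Properties.WithK using (unique∧set⇒bag)
open import Data.List.NonEmpty.Base using (_∷_; toList)
open import Data.List.Properties using (map-∘; map-++; length-++; concatMap-++; upTo-∷ʳ; filter-accept; filter-reject; filter-all; length-map; length-upTo; ∷-injectiveʳ; ∷-injectiveˡ; ∷ʳ-injective)
open import Data.List.Relation.Binary.BagAndSetEquality using (∼bag⇒↭)
open import Data.List.Relation.Binary.Permutation.Propositional using (_↭_; ↭⇒↭ₛ; ↭-refl; ↭-sym; ↭-trans; prep; swap; ↭-reflexive)
open import Data.List.Relation.Binary.Permutation.Propositional.Properties using (↭-length; All-resp-↭; ∈-resp-↭; ++⁺ˡ; ++⁺ʳ; shift; drop-∷; ∷↭∷ʳ; filter-↭)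
open import Data.List.Relation.Binary.Permutation.Setoid.Properties using (Unique-resp-↭)
open import Data.List.Relation.Unary.All as All using (All; []; _∷_)
import Data.List.Relation.Unary.All.Properties as All
open import Data.List.Relation.Unary.AllPairs as AllPairs using (AllPairs; []; _∷_)
import Data.List.Relation.Unary.AllPairs.Properties as AllPairs
open import Data.List.Relation.Unary.Any as Any using (Any; here; there)
import Data.List.Relation.Unary.Any.Properties as Any
open import Data.List.Relation.Unary.Unique.Propositional using (Unique)
import Data.List.Relation.Unary.Unique.Propositional.Properties as Unique
open import Data.Nat.Base as ℕ using (ℕ; zero; suc; _∸_; _<_; _≤_; z≤n; s≤s)
open import Data.Nat.Combinatorics using (_C_; nCk+nC[k+1]≡[n+1]C[k+1]; k>n⇒nCk≡0)
open import Data.Nat.Properties as ℕ using (+-cancelʳ-≤; +-∸-assoc; <-asym; <-irrefl; <-≤-trans; <⇒≢; <⇒≤; <⇒≱; _≟_; _≤?_; m+[n∸m]≡n; m≤n+m; m≤n⇒m≤1+n; suc-injective; ≤-antisym; ≤-pred; ≤-reflexive; ≤-trans; ≰⇒>)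
open import Data.Product.Base using (_×_; _,_; proj₁; proj₂; ∃-syntax)
open import Data.Sum.Base as Sum using (_⊎_; inj₁; inj₂)
open import Function.Base using (_∘_; id; case_of_)
open import Function.Bundles using (_⇔_; mk⇔; Equivalence)
open import Relation.Binary.PropositionalEquality using (_≡_; _≢_; refl; sym; trans; cong; cong₂; subst) renaming (setoid to ≡-setoid)
import Relation.Binary.Reasoning.Setoid as SetoidReasoning
open import Relation.Nullary using (¬_; yes; no)
open import Relation.Nullary.Decidable using (¬?; _×-dec_)
open import Relation.Unary using (Decidable)

open Equivalence

private
  variable
    m N ℓ : ℕ
    xs ys : List ℕ
    B B′ : Block
    bs cs : List Block

-- Insertion of a new element into lists, blocks and distributions

data Insert {A : Set} (x : A) : List A → List A → Set where
  here  : ∀ {xs} → Insert x xs (x ∷ xs)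
  there : ∀ {y xs ys} → Insert x xs ys → Insert x (y ∷ xs) (y ∷ ys)

-- The receiving block `B` is non-empty, so opening a new singleton block does not count as an
-- insertion.
data InsertInto (N : ℕ) : List Block → List Block → Set where
  here  : Insert N (toList B) (toList B′) → InsertInto N (B ∷ bs) (B′ ∷ bs)
  there : InsertInto N bs cs → InsertInto N (B ∷ bs) (B ∷ cs)

-- The relation `Insert` carries the inductions; its enumeration, like the two that follow, is what
-- weights are summed over.
inserts : ∀ {A : Set} → A → List A → List (List A)
inserts x []       = [ x ∷ [] ]
inserts x (y ∷ ys) = (x ∷ y ∷ ys) ∷ map (y ∷_) (inserts x ys)

-- The insertion in front is kept apart because it alone contributes the weight `b`; the rest are
-- the positions behind some element.
insertsBlock : ℕ → Block → List Block
insertsBlock N (x ∷ xs) = (N ∷ x ∷ xs) ∷ map (x ∷_) (inserts N xs)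

insertsInto : ℕ → List Block → List (List Block)
insertsInto N []       = []
insertsInto N (B ∷ bs) = map (_∷ bs) (insertsBlock N B) ++ map (B ∷_) (insertsInto N bs)

length-inserts : ∀ {A : Set} (x : A) xs → length (inserts x xs) ≡ suc (length xs)
length-inserts x []       = refl
length-inserts x (y ∷ ys) = cong suc (trans (length-map (y ∷_) (inserts x ys)) (length-inserts x ys))

∈-inserts⁺ : ∀ {A : Set} {x : A} {xs ys} → Insert x xs ys → ys ∈ inserts x xs
∈-inserts⁺ {xs = []}    here      = here refl
∈-inserts⁺ {xs = _ ∷ _} here      = here refl
∈-inserts⁺              (there i) = there (∈-map⁺ _ (∈-inserts⁺ i))

∈-inserts⁻ : ∀ {A : Set} {x : A} xs {ys} → ys ∈ inserts x xs → Insert x xs ys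
∈-inserts⁻ []       (here refl) = here
∈-inserts⁻ (x ∷ xs) (here refl) = here
∈-inserts⁻ (x ∷ xs) (there p) with _ , q , refl ← ∈-map⁻ _ p = there (∈-inserts⁻ xs q)

∈-insertsBlock⁺ : Insert N (toList B) (toList B′) → B′ ∈ insertsBlock N B
∈-insertsBlock⁺ {B = _ ∷ _} {B′ = _ ∷ _} here      = here refl
∈-insertsBlock⁺ {B = _ ∷ _} {B′ = _ ∷ _} (there i) = there (∈-map⁺ _ (∈-inserts⁺ i))

∈-insertsBlock⁻ : ∀ B → B′ ∈ insertsBlock N B → Insert N (toList B) (toList B′)
∈-insertsBlock⁻ (x ∷ xs) (here refl) = here
∈-insertsBlock⁻ (x ∷ xs) (there p) with _ , q , refl ← ∈-map⁻ _ p = there (∈-inserts⁻ xs q)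

∈-insertsInto⁺ : InsertInto N bs cs → cs ∈ insertsInto N bs
∈-insertsInto⁺ (here i)          = ∈-++⁺ˡ (∈-map⁺ _ (∈-insertsBlock⁺ i))
∈-insertsInto⁺ (there {B = B} i) = ∈-++⁺ʳ (map _ (insertsBlock _ B)) (∈-map⁺ _ (∈-insertsInto⁺ i))

∈-insertsInto⁻ : ∀ bs → cs ∈ insertsInto N bs → InsertInto N bs cs
∈-insertsInto⁻ {N = N} (B ∷ bs) p with ∈-++⁻ (map (_∷ bs) (insertsBlock N B)) p
... | inj₁ q with _ , q′ , refl ← ∈-map⁻ _ q = here (∈-insertsBlock⁻ B q′)
... | inj₂ q with _ , q′ , refl ← ∈-map⁻ _ q = there (∈-insertsInto⁻ bs q′)

Insert⇒∈ : ∀ {A : Set} {x : A} {xs ys} → Insert x xs ys → x ∈ ys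
Insert⇒∈ here      = here refl
Insert⇒∈ (there i) = there (Insert⇒∈ i)

Insert⇒↭ : ∀ {A : Set} {x : A} {xs ys} → Insert x xs ys → ys ↭ x ∷ xs
Insert⇒↭ here              = ↭-refl
Insert⇒↭ (there {y = y} i) = ↭-trans (prep y (Insert⇒↭ i)) (swap y _ ↭-refl)

InsertInto⇒↭ : InsertInto N bs cs → elements cs ↭ N ∷ elements bs
InsertInto⇒↭ (here {bs = bs} i) = ++⁺ʳ (elements bs) (Insert⇒↭ i)
InsertInto⇒↭ {N = N} (there {B = B} i) =
  ↭-trans (++⁺ˡ (toList B) (InsertInto⇒↭ i)) (shift N (toList B) _)

InsertInto⇒length : InsertInto N bs cs → length cs ≡ length bs
InsertInto⇒length (here i)  = refl
InsertInto⇒length (there i) = cong suc (InsertInto⇒length i)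

minimum-∈ : ∀ B → minimum B ∈ toList B
minimum-∈ (x ∷ xs) with argmin-sel id x xs
... | inj₁ eq = here eq
... | inj₂ p  = there p

minimum-≤ : ∀ B → All (minimum B ≤_) (toList B)
minimum-≤ (x ∷ xs) = min≤⊤ x xs ∷ min≤xs x xs

minimum-unique : ∀ {v} B → v ∈ toList B → All (v ≤_) (toList B) → minimum B ≡ v
minimum-unique B v∈ v≤ = ≤-antisym (All.lookup (minimum-≤ B) v∈) (All.lookup v≤ (minimum-∈ B))

-- The old minimum still occurs, and the new entry exceeds it.
Insert⇒minimum : All (_< N) (toList B) → Insert N (toList B) (toList B′) → minimum B′ ≡ minimum B
Insert⇒minimum {B = B} {B′ = B′} <N i = minimum-unique B′
  (∈-resp-↭ (↭-sym (Insert⇒↭ i)) (there (minimum-∈ B)))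
  (All-resp-↭ (↭-sym (Insert⇒↭ i)) (<⇒≤ (All.lookup <N (minimum-∈ B)) ∷ minimum-≤ B))

-- Blocks are listed by their minima, so an insertion that keeps the minima also keeps the listing
-- in order.
InsertInto⇒minima : All (_< N) (elements bs) → InsertInto N bs cs → map minimum cs ≡ map minimum bs
InsertInto⇒minima <N (here {B = B} {B′ = B′} i) =
  cong (_∷ _) (Insert⇒minimum {B = B} {B′ = B′} (All.++⁻ˡ (toList B) <N) i)
InsertInto⇒minima <N (there {B = B} i) = cong (_ ∷_) (InsertInto⇒minima (All.++⁻ʳ (toList B) <N) i)

_≢?_ : ∀ N → Decidable (_≢ N)
(N ≢? j) = ¬? (j ≟ N)

-- A left inverse of every insertion of N; a singleton block of N leaves an empty list behind,
-- which tells it apart from an insertion.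
erase : ℕ → List Block → List (List ℕ)
erase N = map (filter (N ≢?_) ∘ toList)

filter-∉ : All (_< N) xs → filter (N ≢?_) xs ≡ xs
filter-∉ <N = filter-all _ (All.map <⇒≢ <N)

erase-∉ : ∀ bs → All (_< N) (elements bs) → erase N bs ≡ map toList bs
erase-∉ []       <N = refl
erase-∉ (B ∷ bs) <N = cong₂ _∷_ (filter-∉ (All.++⁻ˡ (toList B) <N)) (erase-∉ bs (All.++⁻ʳ (toList B) <N))

filter-Insert : All (_< N) xs → Insert N xs ys → filter (N ≢?_) ys ≡ xs
filter-Insert {N = N} <N here = trans (filter-reject (N ≢?_) (λ p → p refl)) (filter-∉ <N)
filter-Insert {N = N} (x<N ∷ <N) (there i) = trans (filter-accept (N ≢?_) (<⇒≢ x<N)) (cong (_ ∷_) (filter-Insert <N i))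

erase-InsertInto : All (_< N) (elements bs) → InsertInto N bs cs → erase N cs ≡ map toList bs
erase-InsertInto <N (here {B = B} {bs = bs} i) =
  cong₂ _∷_ (filter-Insert (All.++⁻ˡ (toList B) <N) i) (erase-∉ bs (All.++⁻ʳ (toList B) <N))
erase-InsertInto <N (there {B = B} i) =
  cong₂ _∷_ (filter-∉ (All.++⁻ˡ (toList B) <N)) (erase-InsertInto (All.++⁻ʳ (toList B) <N) i)

erase-∷ʳ : ∀ bs → All (_< N) (elements bs) → erase N (bs ∷ʳ (N ∷ [])) ≡ map toList bs ∷ʳ []
erase-∷ʳ {N = N} bs <N = trans (map-++ _ bs _) (cong₂ _++_ (erase-∉ bs <N) (cong [_] (filter-reject (N ≢?_) {xs = []} (λ p → p refl))))

toList-injective : toList B ≡ toList B′ → B ≡ B′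
toList-injective {B = _ ∷ _} {B′ = _ ∷ _} refl = refl

map-toList-injective : ∀ bs cs → map toList bs ≡ map toList cs → bs ≡ cs
map-toList-injective []       []       eq = refl
map-toList-injective (B ∷ bs) (D ∷ cs) eq =
  cong₂ _∷_ (toList-injective (∷-injectiveˡ eq)) (map-toList-injective bs cs (∷-injectiveʳ eq))

inserts-unique : ∀ {A : Set} {x : A} xs → x ∉ xs → Unique (inserts x xs)
inserts-unique []       x∉ = [] ∷ []
inserts-unique (y ∷ ys) x∉ =
  All.map⁺ (All.tabulate (λ _ eq → x∉ (here (∷-injectiveˡ eq))))
  ∷ Unique.map⁺ ∷-injectiveʳ (inserts-unique ys (x∉ ∘ there))

insertsBlock-unique : ∀ B → N ∉ toList B → Unique (insertsBlock N B)
insertsBlock-unique (x ∷ xs) N∉ =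
  All.map⁺ (All.tabulate (λ { _ refl → N∉ (here refl) }))
  ∷ Unique.map⁺ (λ { refl → refl }) (inserts-unique xs (N∉ ∘ there))

insertsInto-unique : ∀ bs → N ∉ elements bs → Unique (insertsInto N bs)
insertsInto-unique []       N∉ = []
insertsInto-unique {N = N} (B ∷ bs) N∉ = Unique.++⁺
  (Unique.map⁺ (λ { refl → refl }) (insertsBlock-unique B (N∉ ∘ ∈-++⁺ˡ)))
  (Unique.map⁺ (λ { refl → refl }) (insertsInto-unique bs (N∉ ∘ ∈-++⁺ʳ (toList B))))
  λ { (p , q) → disj (∈-map⁻ (_∷ bs) p) (∈-map⁻ (B ∷_) q) }
  where
  disj : ∀ {cs} → (∃[ D ] (D ∈ insertsBlock N B × cs ≡ D ∷ bs)) → ¬ (∃[ ds ] (ds ∈ insertsInto N bs × cs ≡ B ∷ ds))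
  -- A common member would have `B` itself as its first block, and that block would contain `N`.
  disj (D , C∈ , refl) (_ , _ , refl) = N∉ (∈-++⁺ˡ (Insert⇒∈ (∈-insertsBlock⁻ B C∈)))

∈⇒Insert : ∀ {A : Set} {x : A} {ys} → x ∈ ys → ∃[ xs ] Insert x xs ys
∈⇒Insert (here refl) = _ , here
∈⇒Insert (there p) with _ , i ← ∈⇒Insert p = _ , there i

-- Taking `N` out of its block leaves a non-empty list, hence a block, unless `N` was alone there.
∈⇒InsertInto : ∀ cs → N ∈ elements cs → (N ∷ []) ∈ cs ⊎ ∃[ bs ] InsertInto N bs cs
∈⇒InsertInto (D ∷ cs) p with ∈-++⁻ (toList D) p
∈⇒InsertInto (D ∷ cs) p | inj₂ q with ∈⇒InsertInto cs q
... | inj₁ N∈       = inj₁ (there N∈)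
... | inj₂ (bs , i) = inj₂ (D ∷ bs , there i)
∈⇒InsertInto ((x ∷ xs) ∷ cs) p | inj₁ q with ∈⇒Insert q
... | []     , here = inj₁ (here refl)
... | y ∷ ys , i    = inj₂ ((y ∷ ys) ∷ cs , here i)

-- Removal of the largest element

[1⋯suc] : ∀ m → [1⋯ suc m ] ≡ [1⋯ m ] ∷ʳ suc m
[1⋯suc] m = trans (cong (map suc) (sym (upTo-∷ʳ m))) (map-++ suc (upTo m) [ m ])

[1⋯suc]-↭ : ∀ m → [1⋯ suc m ] ↭ suc m ∷ [1⋯ m ]
[1⋯suc]-↭ m = ↭-trans (↭-reflexive ([1⋯suc] m)) (↭-sym (∷↭∷ʳ (suc m) [1⋯ m ]))

[1⋯]-< : ∀ m → All (_< suc m) [1⋯ m ]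
[1⋯]-< m = All.map⁺ (All.map s≤s (All.all-upTo m))

isLah⇒↭ : IsLahDistribution m ℓ bs → elements bs ↭ [1⋯ m ]
isLah⇒↭ {m = m} l = ∼bag⇒↭ (unique∧set⇒bag disjoint ([1⋯]-unique m)
  (mk⇔ (All.lookup within) (All.lookup covering)))
  where open IsLahDistribution l

-- One permutation stands for the three conditions on the elements, and the order is a statement
-- about the list of minima: insertion and removal act on exactly these data.
↭⇒isLah : elements bs ↭ [1⋯ m ] → length bs ≡ ℓ → AllPairs _<_ (map minimum bs) → IsLahDistribution m ℓ bs
↭⇒isLah {m = m} p eq o = record
  { disjoint = Unique-resp-↭ (≡-setoid ℕ) (↭⇒↭ₛ (↭-sym p)) ([1⋯]-unique m)
  ; covering = All.tabulate (∈-resp-↭ (↭-sym p))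
  ; within   = All.tabulate (∈-resp-↭ p)
  ; blocks   = eq
  ; ordered  = AllPairs.map⁻ o
  }

isLah⇒minima : IsLahDistribution m ℓ bs → AllPairs _<_ (map minimum bs)
isLah⇒minima = AllPairs.map⁺ ∘ IsLahDistribution.ordered

isLah⇒< : IsLahDistribution m ℓ bs → All (_< suc m) (elements bs)
isLah⇒< {m = m} l = All-resp-↭ (↭-sym (isLah⇒↭ l)) ([1⋯]-< m)

insert-isLah : InsertInto (suc m) bs cs → IsLahDistribution m ℓ bs → IsLahDistribution (suc m) ℓ cs
insert-isLah {m = m} i l = ↭⇒isLah
  (↭-trans (InsertInto⇒↭ i) (↭-trans (prep (suc m) (isLah⇒↭ l)) (↭-sym ([1⋯suc]-↭ m))))
  (trans (InsertInto⇒length i) (IsLahDistribution.blocks l))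
  (subst (AllPairs _<_) (sym (InsertInto⇒minima (isLah⇒< l) i)) (isLah⇒minima l))

uninsert-isLah : InsertInto (suc m) bs cs → IsLahDistribution (suc m) ℓ cs → IsLahDistribution m ℓ bs
uninsert-isLah {m = m} {bs = bs} i l = ↭⇒isLah elements↭
  (trans (sym (InsertInto⇒length i)) (IsLahDistribution.blocks l))
  (subst (AllPairs _<_) (InsertInto⇒minima (All-resp-↭ (↭-sym elements↭) ([1⋯]-< m)) i) (isLah⇒minima l))
  where
  elements↭ : elements bs ↭ [1⋯ m ]
  elements↭ = drop-∷ (↭-trans (↭-sym (InsertInto⇒↭ i)) (↭-trans (isLah⇒↭ l) ([1⋯suc]-↭ m)))

elements-∷ʳ : ∀ bs N → elements (bs ∷ʳ (N ∷ [])) ↭ N ∷ elements bs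
elements-∷ʳ bs N = ↭-trans (↭-reflexive (concatMap-++ toList bs _)) (↭-sym (∷↭∷ʳ N (elements bs)))

-- `suc m` exceeds all earlier minima, so the new singleton belongs at the end of the listing.
∷ʳ-isLah : IsLahDistribution m ℓ bs → IsLahDistribution (suc m) (suc ℓ) (bs ∷ʳ (suc m ∷ []))
∷ʳ-isLah {m = m} {bs = bs} l = ↭⇒isLah
  (↭-trans (elements-∷ʳ bs (suc m)) (↭-trans (prep (suc m) (isLah⇒↭ l)) (↭-sym ([1⋯suc]-↭ m))))
  (trans (length-++ bs) (trans (ℕ.+-comm (length bs) 1) (cong suc (IsLahDistribution.blocks l))))
  (subst (AllPairs _<_) (sym (map-++ minimum bs _))
    (AllPairs.++⁺ (isLah⇒minima l) ([] ∷ [])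
      (All.map⁺ (All.map (_∷ []) (minima-< bs (isLah⇒< l))))))
  where
  minima-< : ∀ bs → All (_< suc m) (elements bs) → All (λ B → minimum B < suc m) bs
  minima-< []       _  = []
  minima-< (B ∷ bs) <N = All.lookup (All.++⁻ˡ (toList B) <N) (minimum-∈ B) ∷ minima-< bs (All.++⁻ʳ (toList B) <N)

AllPairs-++⁻ˡ : ∀ {A : Set} {R : A → A → Set} xs {ys} → AllPairs R (xs ++ ys) → AllPairs R xs
AllPairs-++⁻ˡ []       _        = []
AllPairs-++⁻ˡ (x ∷ xs) (p ∷ ps) = All.++⁻ˡ xs p ∷ AllPairs-++⁻ˡ xs ps

minimum∈elements : ∀ bs → All (_∈ elements bs) (map minimum bs)
minimum∈elements bs = All.map⁺ (All.tabulate (λ {B} B∈ → ∈-concatMap⁺ toList (Any.map (λ { refl → minimum-∈ B }) B∈)))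

-- The blocks are ordered by their minima, so the block of the largest element
-- comes last if it is a singleton.
singleton-last : IsLahDistribution (suc m) ℓ cs → (suc m ∷ []) ∈ cs → ∃[ bs ] cs ≡ bs ∷ʳ (suc m ∷ [])
singleton-last {m = m} {cs = cs} l N∈ = last cs (isLah⇒minima l) minima-≤ N∈
  where
  minima-≤ : All (_< suc (suc m)) (map minimum cs)
  minima-≤ = All.map (All.lookup (isLah⇒< l)) (minimum∈elements cs)

  last : ∀ cs → AllPairs _<_ (map minimum cs) → All (_< suc (suc m)) (map minimum cs) →
         (suc m ∷ []) ∈ cs → ∃[ bs ] cs ≡ bs ∷ʳ (suc m ∷ [])
  last (_ ∷ [])     _             _             (here refl) = [] , refl
  -- A block after the singleton would have a minimum above `suc m`, the largest element.
  last (_ ∷ D ∷ cs) ((N<D ∷ _) ∷ _) (_ ∷ D≤N ∷ _) (here refl) = ⊥-elim (<-irrefl refl (<-≤-trans N<D (≤-pred D≤N)))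
  last (D ∷ cs)     (_ ∷ o)       (_ ∷ ≤N)      (there p)
    with bs , refl ← last cs o ≤N p = D ∷ bs , refl

un∷ʳ-isLah : ∀ bs → IsLahDistribution (suc m) ℓ (bs ∷ʳ (suc m ∷ [])) → IsLahDistribution m (length bs) bs
un∷ʳ-isLah {m = m} bs l = ↭⇒isLah
  (drop-∷ (↭-trans (↭-sym (elements-∷ʳ bs (suc m))) (↭-trans (isLah⇒↭ l) ([1⋯suc]-↭ m))))
  refl
  (AllPairs-++⁻ˡ (map minimum bs) (subst (AllPairs _<_) (map-++ minimum bs _) (isLah⇒minima l)))

-- The two cases of the recurrence as a view. The equation for `ℓ` is a field because `ℓ` may be a
-- sum such as `k + r`, which does not reduce to a successor.
data Removal (m ℓ : ℕ) (cs : List Block) : Set where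
  inserted  : ∀ bs → InsertInto (suc m) bs cs → IsLahDistribution m ℓ bs → Removal m ℓ cs
  singleton : ∀ bs → cs ≡ bs ∷ʳ (suc m ∷ []) → IsLahDistribution m (length bs) bs → ℓ ≡ suc (length bs) → Removal m ℓ cs

removal : IsLahDistribution (suc m) ℓ cs → Removal m ℓ cs
removal {m = m} {cs = cs} l with ∈⇒InsertInto cs (∈-resp-↭ (↭-sym (↭-trans (isLah⇒↭ l) ([1⋯suc]-↭ m))) (here refl))
... | inj₂ (bs , i) = inserted bs i (uninsert-isLah i l)
... | inj₁ N∈ with bs , refl ← singleton-last l N∈ = singleton bs refl (un∷ʳ-isLah bs l)
  (trans (sym (IsLahDistribution.blocks l)) (trans (length-++ bs) (ℕ.+-comm (length bs) 1)))

-- The only member of `𝓛 r 0 0`; it provides the initial value `1#` of the recurrence.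
singletons : ℕ → List Block
singletons zero    = []
singletons (suc r) = singletons r ∷ʳ (suc r ∷ [])

singletons-isLah : ∀ r → IsLahDistribution r r (singletons r)
singletons-isLah zero    = mkLah [] [] [] refl []
singletons-isLah (suc r) = ∷ʳ-isLah (singletons-isLah r)

-- Adding the largest element opens at most one block.
blocks≤elements : ∀ m → IsLahDistribution m ℓ bs → ℓ ≤ m
blocks≤elements {bs = []}    zero (mkLah _ _ _ refl _) = z≤n
blocks≤elements {bs = (_ ∷ _) ∷ _} zero (mkLah _ _ (() ∷ _) _ _)
blocks≤elements (suc m) l with removal l
... | inserted _ _ l′ = m≤n⇒m≤1+n (blocks≤elements m l′)
... | singleton _ _ l′ refl = s≤s (blocks≤elements m l′)

-- The largest element cannot have been inserted, as the remaining `r` elements would then form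
-- `suc r` blocks; so it is a singleton at every stage.
isLah⇒singletons : ∀ r → IsLahDistribution r r bs → bs ≡ singletons r
isLah⇒singletons {bs = []}    zero _ = refl
isLah⇒singletons {bs = _ ∷ _} zero (mkLah _ _ _ () _)
isLah⇒singletons (suc r) l with removal l
... | inserted _ _ l′ = ⊥-elim (<-irrefl refl (blocks≤elements r l′))
... | singleton bs refl l′ eq = cong (_∷ʳ (suc r ∷ []))
  (isLah⇒singletons r (subst (λ ℓ → IsLahDistribution r ℓ bs) (suc-injective (sym eq)) l′))

-- Separated elements

Separated : ℕ → List Block → Set
Separated r bs = AllPairs (λ i j → ¬ SameBlock bs i j) [1⋯ r ]

-- `SameBlock` for lists that may be empty, so that it applies to the output of `erase`.
Together : List (List ℕ) → ℕ → ℕ → Set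
Together xss i j = Any (λ xs → i ∈ xs × j ∈ xs) xss

AllPairs-map-All : ∀ {A : Set} {P : A → Set} {R S : A → A → Set} {xs} → (∀ {i j} → P i → P j → R i j → S i j) →
                   All P xs → AllPairs R xs → AllPairs S xs
AllPairs-map-All f []       []       = []
AllPairs-map-All f (p ∷ ps) (r ∷ rs) =
  All.map (λ (q , s) → f p q s) (All.zip (ps , r)) ∷ AllPairs-map-All f ps rs

erase-together⁺ : ∀ cs {i j} → i ≢ N → j ≢ N → SameBlock cs i j → Together (erase N cs) i j
erase-together⁺ {N = N} cs i≢ j≢ =
  Any.map⁺ ∘ Any.map (λ (i∈ , j∈) → ∈-filter⁺ (N ≢?_) i∈ i≢ , ∈-filter⁺ (N ≢?_) j∈ j≢)

erase-together⁻ : ∀ cs {i j} → Together (erase N cs) i j → SameBlock cs i j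
erase-together⁻ {N = N} cs =
  Any.map (λ (i∈ , j∈) → proj₁ (∈-filter⁻ (N ≢?_) i∈) , proj₁ (∈-filter⁻ (N ≢?_) j∈)) ∘ Any.map⁻

together-∷ʳ[] : ∀ xss {i j} → Together (xss ∷ʳ []) i j → Together xss i j
together-∷ʳ[] xss p with Any.++⁻ xss p
... | inj₁ q = q
... | inj₂ (here (() , _))

[1⋯]-≢ : ∀ {r} → r ≤ m → All (_≢ suc m) [1⋯ r ]
[1⋯]-≢ {r = r} r≤m = All.map (λ i<1+r → <⇒≢ (<-≤-trans i<1+r (s≤s r≤m))) ([1⋯]-< r)

-- Erasing the largest element does not change which smaller elements share a block. The elements of
-- `[1⋯ r ]` are among the smaller ones because `r ≤ m`.
insert-separated : ∀ {r} → r ≤ m → All (_< suc m) (elements bs) → InsertInto (suc m) bs cs →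
                   Separated r bs ⇔ Separated r cs
insert-separated {cs = cs} r≤m <N i = mk⇔
  (AllPairs-map-All (λ i≢ j≢ sep → sep ∘ Any.map⁻ ∘ subst (λ xss → Together xss _ _) (erase-InsertInto <N i)
                       ∘ erase-together⁺ cs i≢ j≢) ([1⋯]-≢ r≤m))
  (AllPairs.map (λ sep → sep ∘ erase-together⁻ cs ∘ subst (λ xss → Together xss _ _) (sym (erase-InsertInto <N i))
                       ∘ Any.map⁺))

-- The erased singleton leaves an empty list, in which no two elements can meet.
∷ʳ-separated : ∀ {r} bs → r ≤ m → All (_< suc m) (elements bs) →
               Separated r bs ⇔ Separated r (bs ∷ʳ (suc m ∷ []))
∷ʳ-separated {m = m} bs r≤m <N = mk⇔
  (AllPairs-map-All (λ i≢ j≢ sep → sep ∘ Any.map⁻ ∘ together-∷ʳ[] (map toList bs)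
                       ∘ subst (λ xss → Together xss _ _) (erase-∷ʳ bs <N)
                       ∘ erase-together⁺ (bs ∷ʳ (suc m ∷ [])) i≢ j≢) ([1⋯]-≢ r≤m))
  (AllPairs.map (λ sep → sep ∘ Any.++⁺ˡ))

elements⁻ : ∀ {i} bs → i ∈ elements bs → Any (λ B → i ∈ toList B) bs
elements⁻ bs = ∈-concatMap⁻ toList {xs = bs}

AllPairs-lookup : ∀ {A : Set} {R : A → A → Set} {xs} → AllPairs R xs →
                  ∀ {i j} → i Fin.< j → R (lookup xs i) (lookup xs j)
AllPairs-lookup (p ∷ ps) {Fin.zero}  {Fin.suc j} _         = All.lookup p (∈-lookup j)
AllPairs-lookup (p ∷ ps) {Fin.suc i} {Fin.suc j} (s≤s i<j) = AllPairs-lookup ps i<j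

-- `f` takes the membership proof as its argument because the block of an element is read off from
-- such a proof.
AllPairs-pigeonhole : ∀ {A : Set} {R : A → A → Set} {n xs} → AllPairs R xs → (f : ∀ {x} → x ∈ xs → Fin n) →
  (∀ {x y} (x∈ : x ∈ xs) (y∈ : y ∈ xs) → f x∈ ≡ f y∈ → ¬ R x y) → length xs ≤ n
AllPairs-pigeonhole {n = n} {xs = xs} ps f ¬R with length xs ≤? n
... | yes p = p
... | no ¬p with i , j , i<j , eq ← pigeonhole (≰⇒> ¬p) (λ i → f (∈-lookup {xs = xs} i)) =
  ⊥-elim (¬R (∈-lookup i) (∈-lookup j) eq (AllPairs-lookup ps i<j))

-- Each element of `[1⋯ r ]` is sent to the position of a block that contains it; two elements with
-- equal positions would share that block.
separated⇒≤ : ∀ {r} bs → All (_∈ elements bs) [1⋯ r ] → Separated r bs → r ≤ length bs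
separated⇒≤ {r} bs covered sep = subst (_≤ length bs) (trans (length-map suc (upTo r)) (length-upTo r))
  (AllPairs-pigeonhole sep (Any.index ∘ block) collide)
  where
  block : ∀ {i} → i ∈ [1⋯ r ] → Any (λ B → i ∈ toList B) bs
  block = elements⁻ bs ∘ All.lookup covered
  collide : ∀ {i j} (i∈ : i ∈ [1⋯ r ]) (j∈ : j ∈ [1⋯ r ]) →
            Any.index (block i∈) ≡ Any.index (block j∈) → ¬ ¬ SameBlock bs i j
  collide i∈ j∈ eq ¬same = ¬same (lose (∈-lookup (Any.index (block i∈)))
    (Any.lookup-index (block i∈) , subst (λ k → _ ∈ toList (lookup bs k)) (sym eq) (Any.lookup-index (block j∈))))

singletons-separated : ∀ r → Separated r (singletons r)
singletons-separated r = AllPairs.map (λ i≢j → i≢j ∘ same r) ([1⋯]-unique r)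
  where
  same : ∀ r {i j} → SameBlock (singletons r) i j → i ≡ j
  same (suc r) p with Any.++⁻ (singletons r) p
  ... | inj₁ q = same r q
  ... | inj₂ (here (here refl , here refl)) = refl

-- The decomposition of `𝓛 r (suc n) k`

[1⋯]-⊆ : ∀ {r} → r ≤ m → All (_∈ [1⋯ m ]) [1⋯ r ]
[1⋯]-⊆ {r = r} r≤m = All.map⁺ (All.map (λ i<r → ∈-map⁺ suc (∈-upTo⁺ (<-≤-trans i<r r≤m))) (All.all-upTo r))

-- There is nothing to append for k = 0: by the pigeonhole principle the r separated elements
-- need r blocks besides the singleton.
Appended : (r n k : ℕ) → List (List Block)
Appended r n zero    = []
Appended r n (suc k) = map (_∷ʳ (suc (n ℕ.+ r) ∷ [])) (𝓛 r n k)

∈-Appended⁺ : ∀ r n k bs → (bs ∷ʳ (suc (n ℕ.+ r) ∷ [])) ∈𝓛[ r , suc n , k ] → (bs ∷ʳ (suc (n ℕ.+ r) ∷ [])) ∈ Appended r n k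
∈-Appended⁺ r n k bs (mk𝓛 l s) = go k l
  where
  l′ : ∀ {ℓ} → IsLahDistribution (suc (n ℕ.+ r)) ℓ (bs ∷ʳ (suc (n ℕ.+ r) ∷ [])) → IsLahDistribution (n ℕ.+ r) (length bs) bs
  l′ = un∷ʳ-isLah bs
  s′ : Separated r bs
  s′ = ∷ʳ-separated bs (m≤n+m r n) (isLah⇒< (l′ l)) .from s
  length-bs : ∀ {ℓ} → IsLahDistribution (suc (n ℕ.+ r)) ℓ (bs ∷ʳ (suc (n ℕ.+ r) ∷ [])) → ℓ ≡ suc (length bs)
  length-bs l = trans (sym (IsLahDistribution.blocks l)) (trans (length-++ bs) (ℕ.+-comm (length bs) 1))
  go : ∀ k → IsLahDistribution (suc (n ℕ.+ r)) (k ℕ.+ r) (bs ∷ʳ (suc (n ℕ.+ r) ∷ [])) → (bs ∷ʳ (suc (n ℕ.+ r) ∷ [])) ∈ Appended r n k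
  go zero    l = ⊥-elim (<-irrefl refl (≤-trans (≤-reflexive (sym (length-bs l))) (separated⇒≤ bs
    (All.map (All.lookup (IsLahDistribution.covering (l′ l))) ([1⋯]-⊆ (m≤n+m r n))) s′)))
  go (suc k) l = ∈-map⁺ _ (∈-𝓛 .from (mk𝓛 (subst (λ ℓ → IsLahDistribution _ ℓ bs) (suc-injective (sym (length-bs l))) (l′ l)) s′))

-- The bound on the elements is passed on for the computation of `erase` that tells appended from
-- inserted distributions.
∈-Appended⁻ : ∀ r n k {cs} → cs ∈ Appended r n k →
  ∃[ bs ] cs ≡ bs ∷ʳ (suc (n ℕ.+ r) ∷ []) × All (_< suc (n ℕ.+ r)) (elements bs) × cs ∈𝓛[ r , suc n , k ]
∈-Appended⁻ r n (suc k) p with bs , q , refl ← ∈-map⁻ _ p with mk𝓛 l s ← ∈-𝓛 {r} {n} {k} .to q =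
  bs , refl , isLah⇒< l , mk𝓛 (∷ʳ-isLah l) (∷ʳ-separated bs (m≤n+m r n) (isLah⇒< l) .to s)

Inserted : (r n k : ℕ) → List (List Block)
Inserted r n k = concatMap (insertsInto (suc (n ℕ.+ r))) (𝓛 r n k)

∈-Inserted⁺ : ∀ r n k {bs cs} → InsertInto (suc (n ℕ.+ r)) bs cs → IsLahDistribution (n ℕ.+ r) (k ℕ.+ r) bs →
              Separated r cs → cs ∈ Inserted r n k
∈-Inserted⁺ r n k {bs} i l s = ∈-concatMap⁺ (insertsInto _)
  (lose (∈-𝓛 .from (mk𝓛 l (insert-separated (m≤n+m r n) (isLah⇒< l) i .from s))) (∈-insertsInto⁺ i))

∈-Inserted⁻ : ∀ r n k {cs} → cs ∈ Inserted r n k →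
  ∃[ bs ] InsertInto (suc (n ℕ.+ r)) bs cs × All (_< suc (n ℕ.+ r)) (elements bs) × cs ∈𝓛[ r , suc n , k ]
∈-Inserted⁻ r n k p with bs , bs∈ , q ← find (∈-concatMap⁻ (insertsInto (suc (n ℕ.+ r))) {xs = 𝓛 r n k} p)
  with mk𝓛 l s ← ∈-𝓛 {r} {n} {k} .to bs∈ | i ← ∈-insertsInto⁻ bs q =
  bs , i , isLah⇒< l , mk𝓛 (insert-isLah i l) (insert-separated (m≤n+m r n) (isLah⇒< l) i .to s)

Appended-unique : ∀ r n k → Unique (Appended r n k)
Appended-unique r n zero    = []
Appended-unique r n (suc k) = Unique.map⁺ (λ {bs} {cs} eq → proj₁ (∷ʳ-injective bs cs eq)) (𝓛-unique r n k)

concatMap-unique : ∀ {A B : Set} (f : A → List B) {xs} → Unique xs → All (Unique ∘ f) xs →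
  (∀ {x y z} → x ∈ xs → y ∈ xs → z ∈ f x → z ∈ f y → x ≡ y) → Unique (concatMap f xs)
concatMap-unique f []       []       inj = []
concatMap-unique f {x ∷ xs} (x≢ ∷ u) (p ∷ ps) inj = Unique.++⁺ p
  (concatMap-unique f u ps (λ x∈ y∈ → inj (there x∈) (there y∈)))
  λ { (z∈ , z∈′) → case find (∈-concatMap⁻ f {xs = xs} z∈′) of λ
      { (y , y∈ , q) → All.lookup x≢ y∈ (inj (here refl) (there y∈) z∈ q) } }

-- `erase` recovers the distribution into which the largest element was inserted, so two sources of
-- the same result coincide.
Inserted-unique : ∀ r n k → Unique (Inserted r n k)
Inserted-unique r n k = concatMap-unique _ (𝓛-unique r n k)
  (All.tabulate (λ {bs} bs∈ → insertsInto-unique bs (λ N∈ → <-irrefl refl (All.lookup (bound bs∈) N∈))))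
  (λ {bs} {cs} bs∈ cs∈ p q → map-toList-injective bs cs
    (trans (sym (erase-InsertInto (bound bs∈) (∈-insertsInto⁻ bs p))) (erase-InsertInto (bound cs∈) (∈-insertsInto⁻ cs q))))
  where
  bound : ∀ {bs} → bs ∈ 𝓛 r n k → All (_< suc (n ℕ.+ r)) (elements bs)
  bound bs∈ = isLah⇒< (_∈𝓛[_,_,_].isLah (∈-𝓛 {r} {n} {k} .to bs∈))

-- The recurrence at the level of sets: both lists are free of repetitions and have the same
-- members, so they agree up to order.
𝓛-suc : ∀ r n k → 𝓛 r (suc n) k ↭ Appended r n k ++ Inserted r n k
𝓛-suc r n k = ∼bag⇒↭ (unique∧set⇒bag (𝓛-unique r (suc n) k)
  (Unique.++⁺ (Appended-unique r n k) (Inserted-unique r n k) disjoint) (mk⇔ split merge))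
  where
  nonempty : ∀ ds → [] ∉ map toList ds
  nonempty ds p with (_ ∷ _) , _ , () ← ∈-map⁻ toList {xs = ds} p

  disjoint : ∀ {cs} → ¬ (cs ∈ Appended r n k × cs ∈ Inserted r n k)
  disjoint (p , q) = clash (∈-Appended⁻ r n k p) (∈-Inserted⁻ r n k q)
    where
    clash : ∀ {cs} →
      ∃[ bs ] cs ≡ bs ∷ʳ (suc (n ℕ.+ r) ∷ []) × All (_< suc (n ℕ.+ r)) (elements bs) × cs ∈𝓛[ r , suc n , k ] →
      ¬ (∃[ ds ] InsertInto (suc (n ℕ.+ r)) ds cs × All (_< suc (n ℕ.+ r)) (elements ds) × cs ∈𝓛[ r , suc n , k ])
    -- Erasure produces an empty list in the appended case and only non-empty lists in the inserted
    -- one.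
    clash (bs , refl , bs< , _) (ds , i , ds< , _) = nonempty ds
      (subst ([] ∈_) (trans (sym (erase-∷ʳ bs bs<)) (erase-InsertInto ds< i)) (∈-++⁺ʳ (map toList bs) (here refl)))

  place : ∀ {cs} → cs ∈𝓛[ r , suc n , k ] → Removal (n ℕ.+ r) (k ℕ.+ r) cs → cs ∈ Appended r n k ++ Inserted r n k
  place (mk𝓛 l s) (inserted bs i l′)      = ∈-++⁺ʳ (Appended r n k) (∈-Inserted⁺ r n k i l′ s)
  place (mk𝓛 l s) (singleton bs refl _ _) = ∈-++⁺ˡ (∈-Appended⁺ r n k bs (mk𝓛 l s))

  split : ∀ {cs} → cs ∈ 𝓛 r (suc n) k → cs ∈ Appended r n k ++ Inserted r n k
  split cs∈ = place cs∈𝓛 (removal (_∈𝓛[_,_,_].isLah cs∈𝓛))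
    where cs∈𝓛 = ∈-𝓛 {r} {suc n} {k} .to cs∈

  merge : ∀ {cs} → cs ∈ Appended r n k ++ Inserted r n k → cs ∈ 𝓛 r (suc n) k
  merge p = ∈-𝓛 {r} {suc n} {k} .from (Sum.[ (λ q → proj₂ (proj₂ (proj₂ (∈-Appended⁻ r n k q))))
                           , (λ q → proj₂ (proj₂ (proj₂ (∈-Inserted⁻ r n k q)))) ] (∈-++⁻ (Appended r n k) p))

𝓛-zero-zero : ∀ r → 𝓛 r 0 0 ↭ [ singletons r ]
𝓛-zero-zero r = ∼bag⇒↭ (unique∧set⇒bag (𝓛-unique r 0 0) ([] ∷ []) (mk⇔
  (λ p → here (isLah⇒singletons r (_∈𝓛[_,_,_].isLah (∈-𝓛 {r} {0} {0} .to p))))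
  λ { (here refl) → ∈-𝓛 .from (mk𝓛 (singletons-isLah r) (singletons-separated r)) }))

-- Record lows under insertion

length-filter-cong : ∀ {A : Set} {P Q : A → Set} (P? : Decidable P) (Q? : Decidable Q) {xs} →
  All (λ x → P x ⇔ Q x) xs → length (filter P? xs) ≡ length (filter Q? xs)
length-filter-cong P? Q? []       = refl
length-filter-cong P? Q? {x ∷ xs} (p ∷ ps) with P? x | Q? x
... | yes _  | yes _  = cong suc (length-filter-cong P? Q? ps)
... | no _   | no _   = length-filter-cong P? Q? ps
... | yes px | no ¬q  = ⊥-elim (¬q (p .to px))
... | no ¬p  | yes qx = ⊥-elim (¬p (p .from qx))

module _ {A : Set} {P Q : A → Set} (P? : Decidable P) (Q? : Decidable Q) where

  -- `P` and `Q` are meant as one statistic read in the new and in the old block: they agree on the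
  -- old entries `xs`, and the new entry `x` is judged separately.
  count-accept : ∀ {x : A} {xs ys} → ys ↭ x ∷ xs → P x → All (λ x → P x ⇔ Q x) xs →
                 length (filter P? ys) ≡ suc (length (filter Q? xs))
  count-accept p px eqs = trans (↭-length (filter-↭ P? p))
    (trans (cong length (filter-accept P? px)) (cong suc (length-filter-cong P? Q? eqs)))

  count-reject : ∀ {x : A} {xs ys} → ys ↭ x ∷ xs → ¬ P x → All (λ x → P x ⇔ Q x) xs →
                 length (filter P? ys) ≡ length (filter Q? xs)
  count-reject p ¬px eqs = trans (↭-length (filter-↭ P? p))
    (trans (cong length (filter-reject P? ¬px)) (length-filter-cong P? Q? eqs))

module _ {A : Set} {P : A → Set} (P? : Decidable P) where

  takeWhile-accept : ∀ {x xs} → P x → takeWhile P? (x ∷ xs) ≡ x ∷ takeWhile P? xs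
  takeWhile-accept {x} px with P? x
  ... | yes _  = refl
  ... | no ¬px = ⊥-elim (¬px px)

  takeWhile-reject : ∀ {x xs} → ¬ P x → takeWhile P? (x ∷ xs) ≡ []
  takeWhile-reject {x} ¬px with P? x
  ... | yes px = ⊥-elim (¬px px)
  ... | no _   = refl

-- By definition `RecordLow B i` is `Low (toList B) i`; plain lists allow induction along the tails.
Low : List ℕ → ℕ → Set
Low xs i = All (λ j → ¬ (j < i)) (takeWhile (i ≢?_) xs)

low-head : ∀ i {xs} → Low (i ∷ xs) i
low-head i = subst (All _) (sym (takeWhile-reject (i ≢?_) (λ p → p refl))) []

low-∷ : ∀ {x i} → x ≢ i → Low (x ∷ xs) i ⇔ (¬ (x < i) × Low xs i)
low-∷ {i = i} x≢i = mk⇔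
  (All.uncons ∘ subst (All _) (takeWhile-accept (i ≢?_) x≢i))
  (λ (p , ps) → subst (All _) (sym (takeWhile-accept (i ≢?_) x≢i)) (p ∷ ps))

-- A larger entry to the left of `i` is no obstacle, and one to its right is not inspected.
low-Insert : ∀ {i} → i < N → Insert N xs ys → Low ys i ⇔ Low xs i
low-Insert i<N here = mk⇔ (proj₂ ∘ low-∷ (<⇒≢ i<N ∘ sym) .to) (λ l → low-∷ (<⇒≢ i<N ∘ sym) .from (<-asym i<N , l))
low-Insert {i = i} i<N (there {y = y} p) with y ≟ i
... | yes refl = mk⇔ (λ _ → low-head y) (λ _ → low-head y)
... | no y≢i   = mk⇔
  (λ l → low-∷ y≢i .from (proj₁ (low-∷ y≢i .to l) , low-Insert i<N p .to (proj₂ (low-∷ y≢i .to l))))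
  (λ l → low-∷ y≢i .from (proj₁ (low-∷ y≢i .to l) , low-Insert i<N p .from (proj₂ (low-∷ y≢i .to l))))

-- The head of the block is already a smaller element to the left, so all positions behind it are
-- treated alike.
¬low : ∀ {x} → x < N → ¬ Low (x ∷ xs) N
¬low x<N l = proj₁ (low-∷ (<⇒≢ x<N) .to l) x<N

nrecᴮ : Block → ℕ
nrecᴮ B = length (filter (λ i → ¬? (recordLow? B i)) (toList B))

rec*ᴮ : Block → ℕ
rec*ᴮ B = length (filter (λ i → recordLow? B i ×-dec ¬? (i ≟ minimum B)) (toList B))

¬-⇔ : ∀ {P Q : Set} → P ⇔ Q → (¬ P) ⇔ (¬ Q)
¬-⇔ e = mk⇔ (_∘ e .from) (_∘ e .to)

low-≢min-⇔ : All (_< N) (toList B) → Insert N (toList B) (toList B′) →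
  All (λ i → (RecordLow B′ i × i ≢ minimum B′) ⇔ (RecordLow B i × i ≢ minimum B)) (toList B)
low-≢min-⇔ {B = B} {B′ = B′} <N p = All.map (λ i<N → mk⇔
  (λ (l , i≢) → low-Insert i<N p .to l , λ eq → i≢ (trans eq (sym min≡)))
  (λ (l , i≢) → low-Insert i<N p .from l , λ eq → i≢ (trans eq min≡))) <N
  where
  min≡ : minimum B′ ≡ minimum B
  min≡ = Insert⇒minimum {B = B} {B′ = B′} <N p

module _ {x xs} (<N : All (_< N) (x ∷ xs)) where

  private
    B₀ B₁ : Block
    B₀ = x ∷ xs
    B₁ = N ∷ x ∷ xs

  nrecᴮ-front : nrecᴮ B₁ ≡ nrecᴮ B₀
  nrecᴮ-front = count-reject (λ i → ¬? (recordLow? B₁ i)) (λ i → ¬? (recordLow? B₀ i))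
    ↭-refl (λ ¬l → ¬l (low-head N)) (All.map (λ i<N → ¬-⇔ (low-Insert i<N here)) <N)

  rec*ᴮ-front : rec*ᴮ B₁ ≡ suc (rec*ᴮ B₀)
  rec*ᴮ-front = count-accept (λ i → recordLow? B₁ i ×-dec ¬? (i ≟ minimum B₁)) (λ i → recordLow? B₀ i ×-dec ¬? (i ≟ minimum B₀))
    ↭-refl
    -- `N` is not the minimum of `B₁`, since that is still the minimum of `B₀`, which lies below
    -- `N`.
    (low-head N , λ N≡ → <-irrefl (trans (sym (Insert⇒minimum {B = B₀} {B′ = B₁} <N here)) (sym N≡)) (All.lookup <N (minimum-∈ B₀)))
    (low-≢min-⇔ {B = B₀} {B′ = B₁} <N here)

  module _ {ys} (p : Insert N xs ys) where

    private
      B₂ : Block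
      B₂ = x ∷ ys

    nrecᴮ-after : nrecᴮ B₂ ≡ suc (nrecᴮ B₀)
    nrecᴮ-after = count-accept (λ i → ¬? (recordLow? B₂ i)) (λ i → ¬? (recordLow? B₀ i))
      (Insert⇒↭ (there p)) (¬low (All.head <N)) (All.map (λ i<N → ¬-⇔ (low-Insert i<N (there p))) <N)

    rec*ᴮ-after : rec*ᴮ B₂ ≡ rec*ᴮ B₀
    rec*ᴮ-after = count-reject (λ i → recordLow? B₂ i ×-dec ¬? (i ≟ minimum B₂)) (λ i → recordLow? B₀ i ×-dec ¬? (i ≟ minimum B₀))
      (Insert⇒↭ (there p)) (λ (l , _) → ¬low (All.head <N) l)
      (low-≢min-⇔ {B = B₀} {B′ = B₂} <N (there p))

nrecᴮ-singleton : ∀ N → nrecᴮ (N ∷ []) ≡ 0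
nrecᴮ-singleton N = cong length (filter-reject (λ i → ¬? (recordLow? (N ∷ []) i)) {xs = []} (λ ¬l → ¬l (low-head N)))

rec*ᴮ-singleton : ∀ N → rec*ᴮ (N ∷ []) ≡ 0
rec*ᴮ-singleton N = cong length (filter-reject (λ i → recordLow? (N ∷ []) i ×-dec ¬? (i ≟ N)) {xs = []} (λ (_ , N≢) → N≢ refl))

nrec-∷ʳ : ∀ bs N → nrec (bs ∷ʳ (N ∷ [])) ≡ nrec bs
nrec-∷ʳ []       N = cong (ℕ._+ 0) (nrecᴮ-singleton N)
nrec-∷ʳ (B ∷ bs) N = cong (nrecᴮ B ℕ.+_) (nrec-∷ʳ bs N)

rec*-∷ʳ : ∀ bs N → rec* (bs ∷ʳ (N ∷ [])) ≡ rec* bs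
rec*-∷ʳ []       N = cong (ℕ._+ 0) (rec*ᴮ-singleton N)
rec*-∷ʳ (B ∷ bs) N = cong (rec*ᴮ B ℕ.+_) (rec*-∷ʳ bs N)

nrec-singletons : ∀ r → nrec (singletons r) ≡ 0
nrec-singletons zero    = refl
nrec-singletons (suc r) = trans (nrec-∷ʳ (singletons r) (suc r)) (nrec-singletons r)

rec*-singletons : ∀ r → rec* (singletons r) ≡ 0
rec*-singletons zero    = refl
rec*-singletons (suc r) = trans (rec*-∷ʳ (singletons r) (suc r)) (rec*-singletons r)

𝓛-empty : ∀ {r n k} → n < k → 𝓛 r n k ≡ []
𝓛-empty {r} {n} {k} n<k = empty (𝓛 r n k) (λ p →
  <⇒≱ n<k (+-cancelʳ-≤ r k n (blocks≤elements (n ℕ.+ r) (_∈𝓛[_,_,_].isLah (∈-𝓛 {r} {n} {k} .to p)))))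
  where
  empty : ∀ (bss : List (List Block)) → (∀ {bs} → bs ∉ bss) → bss ≡ []
  empty []      ∉bss = refl
  empty (_ ∷ _) ∉bss = ⊥-elim (∉bss (here refl))

-- Finite sums and Pascal's rule

module _ {c ℓ} (M : Monoid c ℓ) where

  open Monoid M renaming (refl to ≈-refl; sym to ≈-sym; trans to ≈-trans)
  open RawMonoid rawMonoid using (sum)

  -- Stated for monoids to serve both the last summand in `∑-pascal` and the last factor of the
  -- product in the theorem.
  sum-last : ∀ n (f : ℕ → Carrier) → sum {suc n} (f ∘ toℕ) ≈ sum {n} (f ∘ toℕ) ∙ f n
  sum-last zero    f = ≈-trans (identityʳ (f 0)) (≈-sym (identityˡ (f 0)))
  sum-last (suc n) f = ≈-trans (∙-congˡ (sum-last n (f ∘ suc))) (≈-sym (assoc _ _ _))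

module _ {c ℓ} (R : CommutativeRing c ℓ) where

  open CommutativeRing R hiding (zero) renaming (refl to ≈-refl; sym to ≈-sym; trans to ≈-trans)
  open GeneralizedLah R
  open SetoidReasoning setoid
  open Mult semiring using (×-congʳ; ×-congˡ; ×-homo-+; ×-comm-*; ×-assoc-*)
  open Exp semiring using (^-homo-*; ^-congʳ)
  open SemiringSum semiring using (sum-syntax; sum-cong-≋; ∑-distrib-+; *-distribˡ-sum; sum-replicate-zero)
  open Solver commutativeSemiring using (solve; _:=_; _:+_; _:*_; con)

  ∑ᴸ : ∀ {A : Set} → (A → Carrier) → List A → Carrier
  ∑ᴸ f xs = foldr _+_ 0# (map f xs)

  module _ {A : Set} (f : A → Carrier) where

    ∑ᴸ-↭ : ∀ {xs ys} → xs ↭ ys → ∑ᴸ f xs ≈ ∑ᴸ f ys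
    ∑ᴸ-↭ _↭_.refl           = ≈-refl
    ∑ᴸ-↭ (_↭_.prep x p)     = +-congˡ (∑ᴸ-↭ p)
    ∑ᴸ-↭ (_↭_.swap {xs} {ys} x y p) = begin
      f x + (f y + ∑ᴸ f xs) ≈⟨ +-congˡ (+-congˡ (∑ᴸ-↭ p)) ⟩
      f x + (f y + ∑ᴸ f ys) ≈⟨ solve 3 (λ x y s → x :+ (y :+ s) := y :+ (x :+ s)) ≈-refl (f x) (f y) (∑ᴸ f ys) ⟩
      f y + (f x + ∑ᴸ f ys) ∎
    ∑ᴸ-↭ (_↭_.trans p q)    = ≈-trans (∑ᴸ-↭ p) (∑ᴸ-↭ q)

    ∑ᴸ-++ : ∀ xs ys → ∑ᴸ f (xs ++ ys) ≈ ∑ᴸ f xs + ∑ᴸ f ys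
    ∑ᴸ-++ []       ys = ≈-sym (+-identityˡ _)
    ∑ᴸ-++ (x ∷ xs) ys = ≈-trans (+-congˡ (∑ᴸ-++ xs ys)) (≈-sym (+-assoc _ _ _))

    ∑ᴸ-map : ∀ {B : Set} (g : B → A) xs → ∑ᴸ f (map g xs) ≈ ∑ᴸ (f ∘ g) xs
    ∑ᴸ-map g xs = reflexive (cong (foldr _+_ 0#) (sym (map-∘ xs)))

    ∑ᴸ-concatMap : ∀ {B : Set} (g : B → List A) xs → ∑ᴸ f (concatMap g xs) ≈ ∑ᴸ (∑ᴸ f ∘ g) xs
    ∑ᴸ-concatMap g []       = ≈-refl
    ∑ᴸ-concatMap g (x ∷ xs) = ≈-trans (∑ᴸ-++ (g x) _) (+-congˡ (∑ᴸ-concatMap g xs))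

    ∑ᴸ-*ˡ : ∀ {x g} xs → All (λ y → g y ≈ x * f y) xs → ∑ᴸ g xs ≈ x * ∑ᴸ f xs
    ∑ᴸ-*ˡ []       []       = ≈-sym (zeroʳ _)
    ∑ᴸ-*ˡ (_ ∷ xs) (p ∷ ps) = ≈-trans (+-cong p (∑ᴸ-*ˡ xs ps)) (≈-sym (distribˡ _ _ _))

    ∑ᴸ-const : ∀ {x xs} → All (λ y → f y ≈ x) xs → ∑ᴸ f xs ≈ length xs · x
    ∑ᴸ-const []       = ≈-refl
    ∑ᴸ-const (p ∷ ps) = +-cong p (∑ᴸ-const ps)

  ·-distribˡ : ∀ n x y → n · (x + y) ≈ n · x + n · y
  ·-distribˡ zero    x y = ≈-sym (+-identityˡ 0#)
  ·-distribˡ (suc n) x y = ≈-trans (+-congˡ (·-distribˡ n x y))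
    (solve 4 (λ x y s t → x :+ y :+ (s :+ t) := x :+ s :+ (y :+ t)) ≈-refl x y (n · x) (n · y))

  ·-∑ : ∀ n {k} (f : Fin k → Carrier) → n · (∑[ i < k ] f i) ≈ ∑[ i < k ] (n · f i)
  ·-∑ zero    {k} f = ≈-sym (sum-replicate-zero k)
  ·-∑ (suc n)     f = ≈-trans (+-congˡ (·-∑ n f)) (≈-sym (∑-distrib-+ f (λ i → n · f i)))

  -- A pair of indices with sum `suc n` arises from one with sum `n` by raising either the first or
  -- the second index; Pascal's rule counts these two ways.
  ∑-pascal : ∀ n (f : ℕ → ℕ → Carrier) →
    ∑[ i ≤ suc n ] ((suc n C toℕ i) · f (toℕ i) (suc n ∸ toℕ i)) ≈
    ∑[ i ≤ n ] ((n C toℕ i) · (f (suc (toℕ i)) (n ∸ toℕ i) + f (toℕ i) (suc (n ∸ toℕ i))))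
  ∑-pascal n f = begin
    1 · f 0 (suc n) + ∑[ i ≤ n ] ((suc n C suc (toℕ i)) · g (toℕ i))
      ≈⟨ +-congˡ (sum-cong-≋ {suc n} (λ i → ≈-trans (×-congˡ (sym (nCk+nC[k+1]≡[n+1]C[k+1] n (toℕ i))))
           (×-homo-+ (g (toℕ i)) (n C toℕ i) (n C suc (toℕ i))))) ⟩
    1 · f 0 (suc n) + ∑[ i ≤ n ] ((n C toℕ i) · g (toℕ i) + (n C suc (toℕ i)) · g (toℕ i))
      ≈⟨ +-congˡ (∑-distrib-+ {suc n} u (λ i → (n C suc (toℕ i)) · g (toℕ i))) ⟩
    1 · f 0 (suc n) + (∑[ i ≤ n ] u i + ∑[ i ≤ n ] ((n C suc (toℕ i)) · g (toℕ i)))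
      ≈⟨ solve 3 (λ x y z → x :+ (y :+ z) := y :+ (x :+ z)) ≈-refl _ (∑[ i ≤ n ] u i) _ ⟩
    -- The term split off at index 0 is `h 0` and completes the second sum.
    ∑[ i ≤ n ] u i + ∑[ i ≤ suc n ] h (toℕ i)
      ≈⟨ +-congˡ (sum-last +-monoid (suc n) h) ⟩
    ∑[ i ≤ n ] u i + (∑[ i ≤ n ] h (toℕ i) + h (suc n))
      ≈⟨ +-congˡ (+-congˡ (×-congˡ (k>n⇒nCk≡0 (ℕ.n<1+n n)))) ⟩
    ∑[ i ≤ n ] u i + (∑[ i ≤ n ] h (toℕ i) + 0#)
      ≈⟨ +-congˡ (+-identityʳ _) ⟩
    ∑[ i ≤ n ] u i + ∑[ i ≤ n ] h (toℕ i)
      ≈⟨ ∑-distrib-+ {suc n} u (h ∘ toℕ) ⟨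
    ∑[ i ≤ n ] (u i + h (toℕ i))
      -- Truncated subtraction commutes with the successor here because `i ≤ n`.
      ≈⟨ sum-cong-≋ {suc n} (λ i → ≈-trans (+-congˡ (×-congʳ (n C toℕ i)
           (reflexive (cong (f (toℕ i)) (+-∸-assoc 1 (≤-pred (toℕ<n i)))))))
           (≈-sym (·-distribˡ (n C toℕ i) (g (toℕ i)) (f (toℕ i) (suc (n ∸ toℕ i)))))) ⟩
    ∑[ i ≤ n ] ((n C toℕ i) · (g (toℕ i) + f (toℕ i) (suc (n ∸ toℕ i)))) ∎
    where
    g h : ℕ → Carrier
    g i = f (suc i) (n ∸ i)
    h i = (n C i) · f i (suc n ∸ i)
    u : Fin (suc n) → Carrier
    u i = (n C toℕ i) · g (toℕ i)

  -- Weights and the recurrence for `𝓖`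

  module _ (a b : Carrier) where

    weight : List Block → Carrier
    weight bs = a ^ nrec bs * b ^ rec* bs

    weightᴮ : Block → Carrier
    weightᴮ B = a ^ nrecᴮ B * b ^ rec*ᴮ B

    -- Both statistics are sums over the blocks, so the weight is a product and an insertion can be
    -- studied in one block.
    weight-∷ : ∀ B bs → weight (B ∷ bs) ≈ weightᴮ B * weight bs
    weight-∷ B bs = begin
      a ^ (nrecᴮ B ℕ.+ nrec bs) * b ^ (rec*ᴮ B ℕ.+ rec* bs)
        ≈⟨ *-cong (^-homo-* a (nrecᴮ B) (nrec bs)) (^-homo-* b (rec*ᴮ B) (rec* bs)) ⟩
      (a ^ nrecᴮ B * a ^ nrec bs) * (b ^ rec*ᴮ B * b ^ rec* bs)
        ≈⟨ solve 4 (λ x y z w → (x :* y) :* (z :* w) := (x :* z) :* (y :* w)) ≈-refl (a ^ nrecᴮ B) (a ^ nrec bs) (b ^ rec*ᴮ B) (b ^ rec* bs) ⟩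
      weightᴮ B * weight bs ∎

    weight-∷ʳ : ∀ bs N → weight (bs ∷ʳ (N ∷ [])) ≈ weight bs
    weight-∷ʳ bs N = *-cong (^-congʳ a (nrec-∷ʳ bs N)) (^-congʳ b (rec*-∷ʳ bs N))

    weight-singletons : ∀ r → weight (singletons r) ≈ 1#
    weight-singletons r = ≈-trans (*-cong (^-congʳ a (nrec-singletons r)) (^-congʳ b (rec*-singletons r))) (*-identityˡ 1#)

    -- The front position multiplies the weight by `b`, and each position behind an element
    -- multiplies it by `a`.
    ∑ᴸ-insertsBlock : ∀ {N} B → All (_< N) (toList B) →
                      ∑ᴸ weightᴮ (insertsBlock N B) ≈ (length (toList B) · a + b) * weightᴮ B
    ∑ᴸ-insertsBlock {N} (x ∷ xs) <N = begin
      weightᴮ (N ∷ x ∷ xs) + ∑ᴸ weightᴮ (map (x ∷_) (inserts N xs))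
        ≈⟨ +-cong (*-cong (^-congʳ a (nrecᴮ-front <N)) (^-congʳ b (rec*ᴮ-front <N))) (∑ᴸ-map weightᴮ (x ∷_) (inserts N xs)) ⟩
      u * (b * v) + ∑ᴸ (weightᴮ ∘ (x ∷_)) (inserts N xs)
        ≈⟨ +-congˡ (∑ᴸ-const _ (All.tabulate (λ {ys} ys∈ → let p = ∈-inserts⁻ xs ys∈ in
             *-cong (^-congʳ a (nrecᴮ-after <N p)) (^-congʳ b (rec*ᴮ-after <N p))))) ⟩
      u * (b * v) + length (inserts N xs) · ((a * u) * v)
        ≈⟨ +-congˡ (×-congˡ (length-inserts N xs)) ⟩
      u * (b * v) + suc (length xs) · ((a * u) * v)
        ≈⟨ +-congˡ (×-congʳ (suc (length xs)) (*-assoc a u v)) ⟩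
      u * (b * v) + suc (length xs) · (a * (u * v))
        ≈⟨ +-congˡ (≈-sym (×-assoc-* (suc (length xs)) a (u * v))) ⟩
      u * (b * v) + (suc (length xs) · a) * (u * v)
        ≈⟨ solve 4 (λ u v b l → u :* (b :* v) :+ l :* (u :* v) := (l :+ b) :* (u :* v)) ≈-refl u v b (suc (length xs) · a) ⟩
      (suc (length xs) · a + b) * (u * v) ∎
      where
      u = a ^ nrecᴮ (x ∷ xs)
      v = b ^ rec*ᴮ (x ∷ xs)

    -- An insertion changes the factor of one block only; over all blocks there is one position of
    -- weight `a` per element and one of weight `b` per block.
    ∑ᴸ-insertsInto : ∀ {N} bs → All (_< N) (elements bs) →
                     ∑ᴸ weight (insertsInto N bs) ≈ (length (elements bs) · a + length bs · b) * weight bs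
    ∑ᴸ-insertsInto []       <N = ≈-sym (≈-trans (*-congʳ (+-identityˡ 0#)) (zeroˡ _))
    ∑ᴸ-insertsInto {N} (B ∷ bs) <N = begin
      ∑ᴸ weight (map (_∷ bs) (insertsBlock N B) ++ map (B ∷_) (insertsInto N bs))
        ≈⟨ ∑ᴸ-++ weight (map (_∷ bs) (insertsBlock N B)) _ ⟩
      ∑ᴸ weight (map (_∷ bs) (insertsBlock N B)) + ∑ᴸ weight (map (B ∷_) (insertsInto N bs))
        ≈⟨ +-cong (∑ᴸ-map weight _ (insertsBlock N B)) (∑ᴸ-map weight _ (insertsInto N bs)) ⟩
      ∑ᴸ (λ D → weight (D ∷ bs)) (insertsBlock N B) + ∑ᴸ (λ cs → weight (B ∷ cs)) (insertsInto N bs)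
        ≈⟨ +-cong (∑ᴸ-*ˡ weightᴮ (insertsBlock N B) (All.tabulate (λ {D} _ → ≈-trans (weight-∷ D bs) (*-comm _ _))))
                  (∑ᴸ-*ˡ weight (insertsInto N bs) (All.tabulate (λ {cs} _ → weight-∷ B cs))) ⟩
      weight bs * ∑ᴸ weightᴮ (insertsBlock N B) + weightᴮ B * ∑ᴸ weight (insertsInto N bs)
        ≈⟨ +-cong (*-congˡ (∑ᴸ-insertsBlock B (All.++⁻ˡ (toList B) <N))) (*-congˡ (∑ᴸ-insertsInto bs (All.++⁻ʳ (toList B) <N))) ⟩
      weight bs * ((x + b) * weightᴮ B) + weightᴮ B * ((y + z) * weight bs)
        ≈⟨ solve 6 (λ w v x y z b → w :* ((x :+ b) :* v) :+ v :* ((y :+ z) :* w) := ((x :+ y) :+ (b :+ z)) :* (v :* w))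
             ≈-refl (weight bs) (weightᴮ B) x y z b ⟩
      ((x + y) + (b + z)) * (weightᴮ B * weight bs)
        ≈⟨ *-cong (+-congʳ (≈-trans (≈-sym (×-homo-+ a (length (toList B)) (length (elements bs))))
             (×-congˡ (sym (length-++ (toList B)))))) (≈-sym (weight-∷ B bs)) ⟩
      (length (elements (B ∷ bs)) · a + length (B ∷ bs) · b) * weight (B ∷ bs) ∎
      where
      x = length (toList B) · a
      y = length (elements bs) · a
      z = length bs · b

    -- Junk value 0# at a negative index, where it is only ever multiplied by 𝓖 = 0#.
    multiple : ℤ → Carrier
    multiple (+ k)    = k · b
    multiple -[1+ _ ] = 0#

    𝓖-Appended : ∀ r n k → ∑ᴸ weight (Appended r n k) ≈ 𝓖 a b n (ℤ.pred (+ k)) r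
    -- `ℤ.pred (+ 0)` is negative, where `𝓖` is `0#`; this matches the empty `Appended r n 0`.
    𝓖-Appended r n zero    = ≈-refl
    𝓖-Appended r n (suc k) = begin
      ∑ᴸ weight (map (_∷ʳ S) (𝓛 r n k))       ≈⟨ ∑ᴸ-map weight (_∷ʳ S) (𝓛 r n k) ⟩
      ∑ᴸ (λ bs → weight (bs ∷ʳ S)) (𝓛 r n k)  ≈⟨ ∑ᴸ-*ˡ weight (𝓛 r n k) (All.universal (λ bs → ≈-trans (weight-∷ʳ bs (suc (n ℕ.+ r))) (≈-sym (*-identityˡ _))) (𝓛 r n k)) ⟩
      1# * ∑ᴸ weight (𝓛 r n k)                ≈⟨ *-identityˡ _ ⟩
      ∑ᴸ weight (𝓛 r n k)                     ∎
      where
      S : Block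
      S = suc (n ℕ.+ r) ∷ []

    𝓖-Inserted : ∀ r n k → ∑ᴸ weight (Inserted r n k) ≈ ((n ℕ.+ r) · a + (k ℕ.+ r) · b) * 𝓖 a b n (+ k) r
    𝓖-Inserted r n k = ≈-trans (∑ᴸ-concatMap weight (insertsInto (suc (n ℕ.+ r))) (𝓛 r n k))
      (∑ᴸ-*ˡ weight (𝓛 r n k) (All.tabulate (λ {bs} bs∈ → inserted-weight bs (_∈𝓛[_,_,_].isLah (∈-𝓛 {r} {n} {k} .to bs∈)))))
      where
      inserted-weight : ∀ bs → IsLahDistribution (n ℕ.+ r) (k ℕ.+ r) bs →
        ∑ᴸ weight (insertsInto (suc (n ℕ.+ r)) bs) ≈ ((n ℕ.+ r) · a + (k ℕ.+ r) · b) * weight bs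
      inserted-weight bs l = ≈-trans (∑ᴸ-insertsInto bs (isLah⇒< l))
        (*-congʳ (+-cong (×-congˡ (length-elements l)) (×-congˡ (IsLahDistribution.blocks l))))

    -- The block index runs over all integers because `k - j` and its predecessor can be negative;
    -- in that range every value of `𝓖` is `0#`.
    𝓖-suc : ∀ n z r → 𝓖 a b (suc n) z r ≈
            𝓖 a b n (ℤ.pred z) r + ((n ℕ.+ r) · a + (multiple z + r · b)) * 𝓖 a b n z r
    𝓖-suc n (+ k) r = begin
      ∑ᴸ weight (𝓛 r (suc n) k)
        ≈⟨ ∑ᴸ-↭ weight (𝓛-suc r n k) ⟩
      ∑ᴸ weight (Appended r n k ++ Inserted r n k)
        ≈⟨ ∑ᴸ-++ weight (Appended r n k) (Inserted r n k) ⟩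
      ∑ᴸ weight (Appended r n k) + ∑ᴸ weight (Inserted r n k)
        ≈⟨ +-cong (𝓖-Appended r n k) (𝓖-Inserted r n k) ⟩
      𝓖 a b n (ℤ.pred (+ k)) r + ((n ℕ.+ r) · a + (k ℕ.+ r) · b) * 𝓖 a b n (+ k) r
        ≈⟨ +-congˡ (*-congʳ (+-congˡ (×-homo-+ b k r))) ⟩
      𝓖 a b n (ℤ.pred (+ k)) r + ((n ℕ.+ r) · a + (k · b + r · b)) * 𝓖 a b n (+ k) r ∎
    𝓖-suc n -[1+ k ] r = ≈-sym (≈-trans (+-identityˡ _) (zeroʳ _))

    𝓖-vanishes : ∀ {n k} r → n < k → 𝓖 a b n (+ k) r ≈ 0#
    𝓖-vanishes r n<k = reflexive (cong (∑ᴸ weight) (𝓛-empty n<k))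

    𝓖-zero-zero : ∀ r → 𝓖 a b 0 (+ 0) r ≈ 1#
    𝓖-zero-zero r = ≈-trans (∑ᴸ-↭ weight (𝓛-zero-zero r)) (≈-trans (+-identityʳ _) (weight-singletons r))

    -- `𝓖 a b 0 (k - j) 0` is the Kronecker delta of `j` and `k`: for `j < k` there are too few
    -- elements, for `j > k` the index is negative. If `k` lies beyond the range of summation, `out`
    -- makes the right side vanish as well.
    ∑-sift : ∀ n k (f : ℕ → Carrier) → (n ≤ k → f k ≈ 0#) →
             ∑[ j < n ] (f (toℕ j) * 𝓖 a b 0 (+ k ℤ.- + toℕ j) 0) ≈ f k
    ∑-sift zero    k       f out = ≈-sym (out z≤n)
    ∑-sift (suc n) zero    f out = begin
      f 0 * 𝓖 a b 0 (+ 0) 0 + ∑[ j < n ] (f (suc (toℕ j)) * 0#)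
        ≈⟨ +-cong (*-congˡ (𝓖-zero-zero 0)) (sum-cong-≋ {n} (λ j → zeroʳ (f (suc (toℕ j))))) ⟩
      f 0 * 1# + ∑[ j < n ] 0#
        ≈⟨ +-cong (*-identityʳ (f 0)) (sum-replicate-zero n) ⟩
      f 0 + 0#
        ≈⟨ +-identityʳ (f 0) ⟩
      f 0 ∎
    ∑-sift (suc n) (suc k) f out = begin
      f 0 * 𝓖 a b 0 (+ suc k ℤ.- + 0) 0 + ∑[ j < n ] (f (suc (toℕ j)) * 𝓖 a b 0 (+ suc k ℤ.- + suc (toℕ j)) 0)
        -- The index `+ suc k ℤ.- + 0` computes to `+ suc (k + 0)`, hence the implicit argument.
        ≈⟨ +-cong (≈-trans (*-congˡ (𝓖-vanishes 0 (s≤s (z≤n {k ℕ.+ 0})))) (zeroʳ (f 0)))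
             (sum-cong-≋ {n} (λ j → *-congˡ (reflexive (cong (λ z → 𝓖 a b 0 z 0)
               (trans (ℤ.[1+m]⊖[1+n]≡m⊖n k (toℕ j)) (sym (ℤ.m-n≡m⊖n k (toℕ j)))))))) ⟩
      0# + ∑[ j < n ] (f (suc (toℕ j)) * 𝓖 a b 0 (+ k ℤ.- + toℕ j) 0)
        ≈⟨ +-identityˡ _ ⟩
      ∑[ j < n ] (f (suc (toℕ j)) * 𝓖 a b 0 (+ k ℤ.- + toℕ j) 0)
        ≈⟨ ∑-sift n k (f ∘ suc) (out ∘ s≤s) ⟩
      f (suc k) ∎

    -- The convolution and its recurrence

    module _ (r m : ℕ) where

      factor : ℕ → ℕ → Carrier
      factor j l = l · a + (m ℕ.+ r) · a + (j ℕ.+ r) · b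

      factors : ℕ → ℕ → Carrier
      factors j t = ∏[ l < t ] factor j (toℕ l)

      -- `t` stands for `n - i`; as an independent argument it can be raised while `i` stays fixed.
      summand : ℤ → ℕ → ℕ → ℕ → Carrier
      summand z i t j = 𝓖 a b m (+ j) r * 𝓖 a b i (z ℤ.- + j) 0 * factors j t

      -- `multiple` is not additive at its junk values, so the equation is claimed only after
      -- multiplication by `𝓖`, which is `0#` there.
      multiple-shift : ∀ z j i → (multiple (z ℤ.- + j) + j · b) * 𝓖 a b i (z ℤ.- + j) 0 ≈
                                 multiple z * 𝓖 a b i (z ℤ.- + j) 0
      -- With `w` a variable in place of `z - j`, its sign can be inspected and `z` be replaced by
      -- `w + j`.
      multiple-shift z j i = reindex (z ℤ.- + j) (z-j+j z j)
        where
        z-j+j : ∀ z j → z ≡ z ℤ.- + j ℤ.+ + j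
        z-j+j z j = sym (trans (ℤ.+-assoc z (ℤ.- + j) (+ j))
          (trans (cong (λ w → z ℤ.+ w) (ℤ.+-inverseˡ (+ j))) (ℤ.+-identityʳ z)))
        reindex : ∀ w → z ≡ w ℤ.+ + j → (multiple w + j · b) * 𝓖 a b i w 0 ≈ multiple z * 𝓖 a b i w 0
        reindex (+ k)    refl = *-congʳ (≈-sym (×-homo-+ b k j))
        reindex -[1+ k ] _    = ≈-trans (zeroʳ _) (≈-sym (zeroʳ _))

      -- Raising `i` invokes `𝓖-suc`, raising `t` adds a factor to the product. In the sum of the
      -- two coefficients `j` cancels and `i`, `t` enter only through `i + t`, so the result can be
      -- taken out of both sums.
      summand-suc : ∀ z i t j →
        summand z (suc i) t j + summand z i (suc t) j ≈
        summand (ℤ.pred z) i t j + ((i ℕ.+ t ℕ.+ m ℕ.+ r) · a + (multiple z + r · b)) * summand z i t j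
      summand-suc z i t j = begin
        G * 𝓖 a b (suc i) w 0 * P + G * X * factors j (suc t)
          ≈⟨ +-cong (*-congʳ (*-congˡ (𝓖-suc i w 0))) (*-congˡ (sum-last *-monoid t (factor j))) ⟩
        G * (Y + ((i ℕ.+ 0) · a + (μ + 0#)) * X) * P + G * X * (P * (t · a + M + (j ℕ.+ r) · b))
          ≈⟨ +-cong (*-congʳ (*-congˡ (+-congˡ (*-congʳ (+-congʳ (×-congˡ (ℕ.+-identityʳ i)))))))
                    (*-congˡ (*-congˡ (+-congˡ (×-homo-+ b j r)))) ⟩
        G * (Y + (i · a + (μ + 0#)) * X) * P + G * X * (P * (t · a + M + (j · b + r · b)))
          -- `μ` and `J` are collected next to `X`, the form to which `multiple-shift` applies.
          ≈⟨ solve 10 (λ G Y I μ X P T M J R →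
               G :* (Y :+ (I :+ (μ :+ con 0)) :* X) :* P :+ G :* X :* (P :* (T :+ M :+ (J :+ R))) :=
               G :* Y :* P :+ ((I :+ T :+ M :+ R) :* (G :* X :* P) :+ G :* ((μ :+ J) :* X) :* P))
               ≈-refl G Y (i · a) μ X P (t · a) M (j · b) (r · b) ⟩
        G * Y * P + ((i · a + t · a + M + r · b) * (G * X * P) + G * ((μ + j · b) * X) * P)
          ≈⟨ +-cong (*-congʳ (*-congˡ (reflexive (cong (λ v → 𝓖 a b i v 0) (sym (ℤ.pred-+ z (ℤ.- + j)))))))
                    (+-congˡ (*-congʳ (*-congˡ (multiple-shift z j i)))) ⟩
        G * Y′ * P + ((i · a + t · a + M + r · b) * (G * X * P) + G * (multiple z * X) * P)
          ≈⟨ solve 9 (λ G Y X P I T M R Z →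
               G :* Y :* P :+ ((I :+ T :+ M :+ R) :* (G :* X :* P) :+ G :* (Z :* X) :* P) :=
               G :* Y :* P :+ ((I :+ T :+ M) :+ (Z :+ R)) :* (G :* X :* P))
               ≈-refl G Y′ X P (i · a) (t · a) M (r · b) (multiple z) ⟩
        G * Y′ * P + ((i · a + t · a + M) + (multiple z + r · b)) * (G * X * P)
          ≈⟨ +-congˡ (*-congʳ (+-congʳ collect)) ⟩
        G * Y′ * P + ((i ℕ.+ t ℕ.+ m ℕ.+ r) · a + (multiple z + r · b)) * (G * X * P) ∎
        where
        w  = z ℤ.- + j
        G  = 𝓖 a b m (+ j) r
        X  = 𝓖 a b i w 0
        Y  = 𝓖 a b i (ℤ.pred w) 0
        Y′ = 𝓖 a b i (ℤ.pred z ℤ.- + j) 0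
        P  = factors j t
        M  = (m ℕ.+ r) · a
        μ  = multiple w
        collect : i · a + t · a + M ≈ (i ℕ.+ t ℕ.+ m ℕ.+ r) · a
        collect = ≈-sym (≈-trans (×-congˡ (ℕ.+-assoc (i ℕ.+ t) m r))
          (≈-trans (×-homo-+ a (i ℕ.+ t) (m ℕ.+ r)) (+-congʳ (×-homo-+ a i t))))

      -- Base case of the induction: only `j = z` survives. For `z > m` the right side vanishes too,
      -- and for negative `z` every term does.
      ∑-𝓖-zero : ∀ z → ∑[ j ≤ m ] (𝓖 a b m (+ toℕ j) r * 𝓖 a b 0 (z ℤ.- + toℕ j) 0) ≈ 𝓖 a b m z r
      ∑-𝓖-zero (+ k)    = ∑-sift (suc m) k (λ j → 𝓖 a b m (+ j) r) (𝓖-vanishes r)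
      ∑-𝓖-zero -[1+ k ] = ≈-trans (sum-cong-≋ {suc m} (λ j → ≈-trans
        (*-congˡ (reflexive (cong (λ z → 𝓖 a b 0 z 0) (ℤ.neg-minus-pos k (toℕ j))))) (zeroʳ (𝓖 a b m (+ toℕ j) r))))
        (sum-replicate-zero (suc m))

      total : ℤ → ℕ → ℕ → Carrier
      total z i t = ∑[ j ≤ m ] summand z i t (toℕ j)

      total-suc : ∀ z i t → total z (suc i) t + total z i (suc t) ≈
        total (ℤ.pred z) i t + ((i ℕ.+ t ℕ.+ m ℕ.+ r) · a + (multiple z + r · b)) * total z i t
      total-suc z i t = begin
        total z (suc i) t + total z i (suc t)
          ≈⟨ ∑-distrib-+ {suc m} (summand z (suc i) t ∘ toℕ) (summand z i (suc t) ∘ toℕ) ⟨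
        ∑[ j ≤ m ] (summand z (suc i) t (toℕ j) + summand z i (suc t) (toℕ j))
          ≈⟨ sum-cong-≋ {suc m} (λ j → summand-suc z i t (toℕ j)) ⟩
        ∑[ j ≤ m ] (summand (ℤ.pred z) i t (toℕ j) + x * summand z i t (toℕ j))
          ≈⟨ ∑-distrib-+ {suc m} (summand (ℤ.pred z) i t ∘ toℕ) (λ j → x * summand z i t (toℕ j)) ⟩
        total (ℤ.pred z) i t + ∑[ j ≤ m ] (x * summand z i t (toℕ j))
          ≈⟨ +-congˡ (*-distribˡ-sum {suc m} x (summand z i t ∘ toℕ)) ⟨
        total (ℤ.pred z) i t + x * total z i t ∎
        where
        x = (i ℕ.+ t ℕ.+ m ℕ.+ r) · a + (multiple z + r · b)

      -- The theorem for all integers `z`, since the induction on `n` also uses the statement for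
      -- `ℤ.pred z`.
      𝓖-+ : ∀ n z → 𝓖 a b (n ℕ.+ m) z r ≈ ∑[ i ≤ n ] ((n C toℕ i) · total z (toℕ i) (n ∸ toℕ i))
      𝓖-+ zero    z = begin
        𝓖 a b m z r
          ≈⟨ ∑-𝓖-zero z ⟨
        ∑[ j ≤ m ] (𝓖 a b m (+ toℕ j) r * 𝓖 a b 0 (z ℤ.- + toℕ j) 0)
          ≈⟨ sum-cong-≋ {suc m} (λ j → *-identityʳ (𝓖 a b m (+ toℕ j) r * 𝓖 a b 0 (z ℤ.- + toℕ j) 0)) ⟨
        total z 0 0
          -- One `0#` comes from the one-term sum, the other from the multiple by `0 C 0`, which is
          -- 1.
          ≈⟨ ≈-trans (+-identityʳ _) (+-identityʳ _) ⟨
        ∑[ i ≤ 0 ] ((0 C toℕ i) · total z (toℕ i) (0 ∸ toℕ i)) ∎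
      𝓖-+ (suc n) z = begin
        𝓖 a b (suc (n ℕ.+ m)) z r
          ≈⟨ 𝓖-suc (n ℕ.+ m) z r ⟩
        𝓖 a b (n ℕ.+ m) (ℤ.pred z) r + x * 𝓖 a b (n ℕ.+ m) z r
          ≈⟨ +-cong (𝓖-+ n (ℤ.pred z)) (*-congˡ (𝓖-+ n z)) ⟩
        ∑[ i ≤ n ] u i + x * ∑[ i ≤ n ] v i
          ≈⟨ +-congˡ (*-distribˡ-sum {suc n} x v) ⟩
        ∑[ i ≤ n ] u i + ∑[ i ≤ n ] (x * v i)
          ≈⟨ ∑-distrib-+ {suc n} u (λ i → x * v i) ⟨
        ∑[ i ≤ n ] (u i + x * v i)
          ≈⟨ sum-cong-≋ {suc n} (λ i → step (toℕ i) (≤-pred (toℕ<n i))) ⟩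
        ∑[ i ≤ n ] ((n C toℕ i) · (total z (suc (toℕ i)) (n ∸ toℕ i) + total z (toℕ i) (suc (n ∸ toℕ i))))
          ≈⟨ ∑-pascal n (total z) ⟨
        ∑[ i ≤ suc n ] ((suc n C toℕ i) · total z (toℕ i) (suc n ∸ toℕ i)) ∎
        where
        x = (n ℕ.+ m ℕ.+ r) · a + (multiple z + r · b)
        u v : Fin (suc n) → Carrier
        u i = (n C toℕ i) · total (ℤ.pred z) (toℕ i) (n ∸ toℕ i)
        v i = (n C toℕ i) · total z (toℕ i) (n ∸ toℕ i)
        step : ∀ i → i ≤ n → (n C i) · total (ℤ.pred z) i (n ∸ i) + x * ((n C i) · total z i (n ∸ i)) ≈
               (n C i) · (total z (suc i) (n ∸ i) + total z i (suc (n ∸ i)))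
        step i i≤n = begin
          (n C i) · total (ℤ.pred z) i (n ∸ i) + x * ((n C i) · total z i (n ∸ i))
            ≈⟨ +-congˡ (×-comm-* (n C i) x _) ⟩
          (n C i) · total (ℤ.pred z) i (n ∸ i) + (n C i) · (x * total z i (n ∸ i))
            ≈⟨ ·-distribˡ (n C i) _ _ ⟨
          (n C i) · (total (ℤ.pred z) i (n ∸ i) + x * total z i (n ∸ i))
            -- The coefficient `x` serves every `i` because `i + (n ∸ i)` is `n`.
            ≈⟨ ×-congʳ (n C i) (+-congˡ (*-congʳ (+-congʳ (×-congˡ (cong (λ k → k ℕ.+ m ℕ.+ r) (m+[n∸m]≡n i≤n)))))) ⟨
          (n C i) · (total (ℤ.pred z) i (n ∸ i) + ((i ℕ.+ (n ∸ i) ℕ.+ m ℕ.+ r) · a + (multiple z + r · b)) * total z i (n ∸ i))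
            ≈⟨ ×-congʳ (n C i) (total-suc z i (n ∸ i)) ⟨
          (n C i) · (total z (suc i) (n ∸ i) + total z i (suc (n ∸ i))) ∎

theorem2p5 : ∀ {c ℓ} (R : CommutativeRing c ℓ) →
    let open CommutativeRing R
        open GeneralizedLah R
    in ∀ (a b : Carrier) (r n m k : ℕ) →
       𝓖 a b (n ℕ.+ m) (+ k) r
         ≈ ∑[ i ≤ n ] (∑[ j ≤ m ]
             ((n C toℕ i) · ((𝓖 a b m (+ toℕ j) r * 𝓖 a b (toℕ i) (+ k ℤ.- + toℕ j) 0)
               * ∏[ l < n ∸ toℕ i ] (toℕ l · a + (m ℕ.+ r) · a + (toℕ j ℕ.+ r) · b))))
-- It remains to move the binomial coefficient inside the sum over `j`.
theorem2p5 R a b r n m k = ≈-trans (𝓖-+ R a b r m n (+ k))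
  (sum-cong-≋ {suc n} (λ i → ·-∑ R (n C toℕ i) {suc m} (summand R a b r m (+ k) (toℕ i) (n ∸ toℕ i) ∘ toℕ)))
  where
  open CommutativeRing R using (semiring) renaming (trans to ≈-trans)
  open SemiringSum semiring using (sum-cong-≋)
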